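{- Let $p$ be a prime and let $a,b$ be positive integers with $b>1$, such that $k=\frac{p^{ab}-1}{b(p^a-1)}$ is an integer and $b(p^a-1)$ is a primitive divisor of $p^{ab}-1$. Let $\omega$ be a primitive element of $\mathbb{F}_{p^{ab}}$, so that $\{1,\omega^k,\ldots,\omega^{(b-1)k}\}$ is an $\mathbb{F}_{p^a}$-basis of $\mathbb{F}_{p^{ab}}$, and for $\alpha\in\mathbb{F}_{p^{ab}}$ let $[\alpha]_i$ denote the $i$-th coordinate of $\alpha$ in this basis. Let $\alpha\in\mathbb{F}_{p^{ab}}$, let $s\ge1$, and let $M_s$ be the number of solutions $(x_1,\ldots,x_s)\in(\mathbb{F}_{p^{ab}})^s$ of $x_1^{k}+\cdots+x_{s}^k=\alpha$. Then $$M_s=\begin{cases}\sum_{r=1}^{s}\binom{s}{r}N_{r} & \text{if } \alpha\ne 0,\\[1mm] 1+\sum_{r=1}^{s}\binom{s}{r}N_{r} & \text{if } \alpha= 0,\end{cases}$$ where $$N_r=k^{r}\sum_{\substack{r_1+\cdots+r_b=r\\ r_i\ge0}} \frac{r!}{r_{1}!\cdots r_{b}!}\prod_{i=1}^b a_{i}(\alpha),\qquad a_{i}(\alpha)=\begin{cases} \frac{p^{a}-1}{p^{a}}\big((p^{a}-1)^{r_i-1}-(-1)^{r_i-1}\big) & \text{if } [\alpha]_i=0, \\[1mm] \frac{1}{p^{a}}\big((p^{a}-1)^{r_i}-(-1)^{r_i}\big) & \text{if } [\alpha]_i\neq 0. \end{cases}$$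
   Context: A divisor $u$ of $p^m-1$ is primitive if $u\nmid p^h-1$ for all $1\le h<m$. ($N_r$ equals the number of solutions in $(\mathbb{F}_{p^{ab}}^*)^r$ of $x_1^k+\cdots+x_r^k=\alpha$.) -}

module Defs where

open import Level using (Level; _⊔_)
open import Algebra.Bundles using (CommutativeRing)
open import Data.Nat as ℕ using (ℕ; zero; suc; _∸_; _≤_; _<_)
open import Data.Nat.Divisibility using (_∣_)
open import Data.Nat.Primality using (Prime)
open import Data.Nat.Combinatorics using (_C_)
open import Data.Fin using (Fin)
import Data.Fin as Fin
open import Data.Vec using (Vec; []; _∷_; lookup; toList)
open import Data.List using (List; []; _∷_; map; concatMap; filter; length; allFin)
import Data.List as List
open import Data.Product using (Σ; ∃; _×_; _,_)
open import Relation.Nullary using (¬_; Dec; yes; no)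
open import Relation.Binary.PropositionalEquality using (_≡_; _≢_)
open import Data.Rational as ℚ using (ℚ; 0ℚ; 1ℚ; _≟_; ≢-nonZero)
import Data.Integer as ℤ

record IsFieldDec {c ℓ} (R : CommutativeRing c ℓ) : Set (c ⊔ ℓ) where
  open CommutativeRing R
  field
    _≈?_    : (x y : Carrier) → Dec (x ≈ y)
    1≉0     : ¬ (1# ≈ 0#)
    inverse : ∀ x → ¬ (x ≈ 0#) → ∃ λ y → (x * y) ≈ 1#

record FiniteOfOrder {c ℓ} (R : CommutativeRing c ℓ) (q : ℕ) : Set (c ⊔ ℓ) where
  open CommutativeRing R
  field
    enum       : Fin q → Carrier
    enum-inj   : ∀ i j → enum i ≈ enum j → i ≡ j
    enum-surj  : ∀ x → ∃ λ i → enum i ≈ x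

module FieldOps {c ℓ} (R : CommutativeRing c ℓ) where
  open CommutativeRing R

  pow : Carrier → ℕ → Carrier
  pow x zero    = 1#
  pow x (suc n) = x * pow x n

  sumF : ∀ n → (Fin n → Carrier) → Carrier
  sumF zero    f = 0#
  sumF (suc n) f = f Fin.zero + sumF n (λ i → f (Fin.suc i))

  IsPrimitiveElement : Carrier → Set (c ⊔ ℓ)
  IsPrimitiveElement ω = ∀ x → ¬ (x ≈ 0#) → ∃ λ j → pow ω j ≈ x

  -- membership in the subfield F_{Q} = { x | x^Q = x } (Q = p^a)
  InSubfield : ℕ → Carrier → Set ℓ
  InSubfield Q x = pow x Q ≈ x

  IsCoordVec : (Q k b : ℕ) → Carrier → Carrier → (Fin b → Carrier) → Set (ℓ)
  IsCoordVec Q k b ω α cs =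
    (∀ i → InSubfield Q (cs i)) ×
    (α ≈ sumF b (λ i → cs i * pow ω (Fin.toℕ i ℕ.* k)))

allVecs : (q s : ℕ) → List (Vec (Fin q) s)
allVecs q zero    = [] ∷ []
allVecs q (suc s) = concatMap (λ i → map (i ∷_) (allVecs q s)) (allFin q)

compositions : (b r : ℕ) → List (Vec ℕ b)
compositions zero    zero    = [] ∷ []
compositions zero    (suc r) = []
compositions (suc b) r =
  concatMap (λ j → map (j ∷_) (compositions b (r ∸ j))) (List.upTo (suc r))

ℕ→ℚ : ℕ → ℚ
ℕ→ℚ n = ℤ.+ n ℚ./ 1

-- total reciprocal (only used at nonzero arguments)
recip : ℚ → ℚ
recip x with x ≟ 0ℚ
... | yes _ = 0ℚ
... | no x≢0 = ℚ.1/_ x {{≢-nonZero x≢0}}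

powℚ : ℚ → ℕ → ℚ
powℚ x zero    = 1ℚ
powℚ x (suc n) = x ℚ.* powℚ x n

-- x ^ (n - 1) with integer exponent: x^{-1} when n = 0
powPred : ℚ → ℕ → ℚ
powPred x zero    = recip x
powPred x (suc n) = powℚ x n

sumℚ : List ℚ → ℚ
sumℚ = List.foldr ℚ._+_ 0ℚ

prodℚ : List ℚ → ℚ
prodℚ = List.foldr ℚ._*_ 1ℚ

-- a_i(α) for given r_i, where Q = p^a and zeroCoord says [α]_i = 0
aCoeff : ∀ {z} (Q : ℕ) → (zeroCoord : Set z) → Dec zeroCoord → (ri : ℕ) → ℚ
aCoeff Q _ (yes _) ri =
  ((ℕ→ℚ Q ℚ.- 1ℚ) ℚ.* recip (ℕ→ℚ Q)) ℚ.*
  (powPred (ℕ→ℚ Q ℚ.- 1ℚ) ri ℚ.- powPred (ℚ.- 1ℚ) ri)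
aCoeff Q _ (no _) ri =
  recip (ℕ→ℚ Q) ℚ.* (powℚ (ℕ→ℚ Q ℚ.- 1ℚ) ri ℚ.- powℚ (ℚ.- 1ℚ) ri)

multinomial : ∀ {b} → ℕ → Vec ℕ b → ℚ
multinomial r rs = ℕ→ℚ (r ℕ.!) ℚ.* recip (prodℚ (map (λ x → ℕ→ℚ (x ℕ.!)) (toList rs)))

-- N_r, given Q = p^a, k, b, and a decision of [α]_i = 0 for each i
Nr : ∀ {z} (Q k b : ℕ) (Z : Fin b → Set z) (dZ : ∀ i → Dec (Z i)) → ℕ → ℚ
Nr Q k b Z dZ r =
  powℚ (ℕ→ℚ k) r ℚ.*
  sumℚ (map (λ rs → multinomial r rs ℚ.*
                     prodℚ (map (λ i → aCoeff Q (Z i) (dZ i) (lookup rs i)) (allFin b)))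
            (compositions b r))

binomSum : (s : ℕ) → (ℕ → ℚ) → ℚ
binomSum s N = sumℚ (map (λ r → ℕ→ℚ (s C r) ℚ.* N r) (List.drop 1 (List.upTo (suc s))))

IsPrimitiveDivisor : (u p m : ℕ) → Set
IsPrimitiveDivisor u p m =
  (u ∣ (p ℕ.^ m ∸ 1)) × (∀ h → 1 ≤ h → h < m → ¬ (u ∣ (p ℕ.^ h ∸ 1)))

module Counting {c ℓ} (R : CommutativeRing c ℓ) (dec : IsFieldDec R)
                {q : ℕ} (fin : FiniteOfOrder R q) where
  open CommutativeRing R
  open IsFieldDec dec
  open FiniteOfOrder fin
  open FieldOps R

  Ms : (k s : ℕ) → Carrier → ℕ
  Ms k s α = length (filter (λ v → sumF s (λ i → pow (enum (lookup v i)) k) ≈? α)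
                            (allVecs q s))

{-# OPTIONS --safe #-}

-- Let ζ = ω ^ k, θ = ζ ^ b and Q = p ^ a. Then θ generates the units of the subfield K of order Q,
-- and x ↦ x ^ k maps the units of the field k-to-one onto the elements θ ^ l ζ ^ i with l < Q - 1
-- and i < b. Since b (Q - 1) is a primitive divisor, the b conjugates ζ ^ (Q ^ j) are distinct, so
-- 1, ζ, …, ζ ^ (b - 1) are independent over K, and they form a basis by counting.
-- Splitting off one variable gives
--   M (s + 1) α = M s α + k Σ_{i, l} M s (α - θ ^ l ζ ^ i),
-- where subtracting θ ^ l ζ ^ i changes only the i-th coordinate, by a unit of K. The claimed
-- formula satisfies the same recurrence: a_i does so in its single coordinate, and the multinomial
-- sum is an iterated binomial convolution, to which the Leibniz rule applies.

module Submission where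

open import Defs
open import Algebra.Bundles using (CommutativeRing)
open import Data.Bool using (true; false)
open import Data.Fin as Fin
  using (Fin; toℕ; fromℕ; fromℕ<; inject₁; finToFun; funToFin; combine; punchIn; punchOut; _↑ˡ_;
    _↑ʳ_)
open import Data.Fin.Properties as Fin
  using (toℕ<n; toℕ-fromℕ; toℕ-inject₁; toℕ-fromℕ<; toℕ-injective; toℕ-combine; injective⇒≤;
    pigeonhole; punchInᵢ≢i; punchOut-injective; any?; ¬∀⟶∃¬)
import Data.Integer as ℤ
import Data.Integer.Properties as ℤ
open import Data.List as List
  using (List; []; _∷_; map; concatMap; filter; length; allFin; upTo; applyUpTo; tabulate; _++_)
open import Data.List.Properties
  using (map-++; map-∘; map-cong; map-tabulate; filter-≐; filter-++; length-++)
open import Data.Nat as ℕ using (ℕ; zero; suc; _∸_; _!; NonZero)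
import Data.Nat.Properties as ℕ
open import Data.Nat.Combinatorics
  using (_C_; nCn≡1; nCk+nC[k+1]≡[n+1]C[k+1]; k>n⇒nCk≡0; nCk≡n!/k![n-k]!; k![n∸k]!∣n!)
open import Data.Nat.Divisibility using (_∣_; divides; ∣⇒≤; ∣1⇒≡1; m∣m*n; m%n≡0⇒n∣m; *-cancelˡ-∣)
open import Data.Nat.DivMod using (_%_; _/_; m≡m%n+[m/n]*n; m%n<n; m/n*n≡m)
open import Data.Nat.Primality
  using (Prime; euclidsLemma; prime⇒nonZero; prime⇒nonTrivial; ¬prime[0]; ¬prime[1])
open import Data.Product using (_,_; _×_; ∃; Σ; proj₁; proj₂)
open import Data.Rational as ℚ using (ℚ; 0ℚ; 1ℚ)
import Data.Rational as Q
import Data.Rational.Properties as ℚ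
import Data.Rational.Unnormalised as ℚᵘ
import Data.Rational.Unnormalised.Properties as ℚᵘ
open import Data.Sum using (inj₁; inj₂)
open import Data.Vec using (Vec; []; _∷_; lookup; toList)
open import Data.Vec.Functional using (updateAt)
open import Function using (_∘_; id; mk↔ₛ′; Injective)
open import Relation.Binary.Definitions using (tri<; tri≈; tri>)
open import Relation.Binary.PropositionalEquality as ≡ using (_≡_; _≢_)
open import Relation.Nullary using (¬_; Dec; yes; no; contradiction; does)
open import Relation.Nullary.Decidable using (dec⇒maybe)
open import Relation.Unary using (Decidable)
open import Tactic.RingSolver using (solve-∀)
open import Tactic.RingSolver.Core.AlmostCommutativeRing
  using (AlmostCommutativeRing; fromCommutativeRing)

-- Arithmetic and finite maps

-- Why the binomials appear: let T send a function f of α to k times the sum of f (α - θ ^ l ζ ^ i)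
-- over all i and l. The recurrence says that M s is (1 + T) ^ s applied to the indicator of α = 0,
-- and T takes N_r to N_(r+1), where N_0 is that same indicator. Expanding the power gives the sum
-- over r, and the extra 1 for α = 0 is its term r = 0. That N_0 is the indicator depends on reading
-- the exponent r_i - 1 as -1 when r_i = 0: then a_i is 1 at a zero coordinate and 0 at a nonzero
-- one. In a single coordinate a_i counts the ways to write [α]_i as an ordered sum of r_i units of
-- K, and its two recurrences are those of this count. Since the recurrence for M moves α, the
-- induction on s has to range over all coordinate vectors at once.

nCk*k!*[n∸k]!≡n! : ∀ {n k} → k ℕ.≤ n → (n C k) ℕ.* (k ! ℕ.* (n ∸ k) !) ≡ n !
nCk*k!*[n∸k]!≡n! {n} {k} k≤n = ≡.trans (≡.cong (ℕ._* (k ! ℕ.* (n ∸ k) !)) (nCk≡n!/k![n-k]! k≤n))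
  (m/n*n≡m (k![n∸k]!∣n! k≤n))
  where instance _ = k ℕ.!* (n ∸ k) !≢0

prime∤! : ∀ {p} → Prime p → ∀ {j} → j ℕ.< p → ¬ p ∣ j !
prime∤! pr {zero}  _   p∣1 = ¬prime[1] (≡.subst Prime (∣1⇒≡1 p∣1) pr)
prime∤! pr {suc j} j<p p∣  with euclidsLemma (suc j) (j !) pr p∣
... | inj₁ p∣j = ℕ.<⇒≱ j<p (∣⇒≤ p∣j)
... | inj₂ p∣j! = prime∤! pr (ℕ.<-trans (ℕ.n<1+n j) j<p) p∣j!

-- The prime divides `p !`, which is `p C j` times two factorials of numbers below `p`, and it
-- divides neither of these factorials.
prime∣C : ∀ {p} → Prime p → ∀ {j} → 0 ℕ.< j → j ℕ.< p → p ∣ p C j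
prime∣C {p} pr {j} 0<j j<p with euclidsLemma (p C j) (j ! ℕ.* (p ∸ j) !) pr p∣p!
  where
  p∣p! : p ∣ (p C j) ℕ.* (j ! ℕ.* (p ∸ j) !)
  p∣p! = ≡.subst (p ∣_) (≡.sym (nCk*k!*[n∸k]!≡n! (ℕ.<⇒≤ j<p)))
    (self p {{prime⇒nonZero pr}})
    where
    self : ∀ n → .{{NonZero n}} → n ∣ n !
    self (suc n) = m∣m*n (n !)
... | inj₁ p∣C = p∣C
... | inj₂ p∣ with euclidsLemma (j !) ((p ∸ j) !) pr p∣
... | inj₁ p∣j! = contradiction p∣j! (prime∤! pr j<p)
... | inj₂ p∣  = contradiction p∣ (prime∤! pr (ℕ.∸-monoʳ-< 0<j (ℕ.<⇒≤ j<p)))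

-- A missed value `y` could be punched out of the codomain, leaving an injection from `Fin m` into a
-- set of fewer than `m` elements.
injective⇒surjective : ∀ {m n} → n ℕ.≤ m → (f : Fin m → Fin n) → Injective _≡_ _≡_ f → ∀ y → ∃ λ x → f x ≡ y
injective⇒surjective {m} {suc n} n≤m f f-inj y with any? (λ x → f x Fin.≟ y)
... | yes found = found
... | no  ¬found = contradiction (injective⇒≤ {f = λ x → punchOut (y≢f x)} g-inj) (ℕ.<⇒≱ n≤m)
  where
  y≢f : ∀ x → y ≢ f x
  y≢f x y≡ = ¬found (x , ≡.sym y≡)
  g-inj : Injective _≡_ _≡_ (λ x → punchOut (y≢f x))
  g-inj {x} {x′} eq = f-inj (punchOut-injective (y≢f x) (y≢f x′) eq)

funToFin-cong : ∀ {m n} {f g : Fin m → Fin n} → (∀ i → f i ≡ g i) → funToFin f ≡ funToFin g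
funToFin-cong {zero}  f≗g = ≡.refl
funToFin-cong {suc m} f≗g = ≡.cong₂ Fin.combine (f≗g Fin.zero) (funToFin-cong (f≗g ∘ Fin.suc))

finToFun-injective : ∀ {m n} (e e′ : Fin (m ℕ.^ n)) → (∀ i → finToFun {m} {n} e i ≡ finToFun e′ i) → e ≡ e′
finToFun-injective {m} {n} e e′ eq = begin
  e                               ≡⟨ Fin.funToFin-finToFin {n} {m} e ⟨
  funToFin {n} (finToFun {m} e)   ≡⟨ funToFin-cong {n} {m} eq ⟩
  funToFin {n} (finToFun {m} e′)  ≡⟨ Fin.funToFin-finToFin {n} {m} e′ ⟩
  e′                              ∎
  where open ≡.≡-Reasoning

-- Rational sums and the weights a_i

module RationalSums where
  open ≡ using (refl; sym; trans; cong; cong₂; subst)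
  open ≡.≡-Reasoning
  open Q using (_+_; _*_; -_; _-_; _≟_; ≢-nonZero; toℚᵘ)
  open import Algebra.Properties.Semiring.Sum (CommutativeRing.semiring ℚ.+-*-commutativeRing)
    using (sum; sum-cong-≗; sum-remove; ∑-distrib-+; *-distribˡ-sum)

  ℚ-ring : AlmostCommutativeRing _ _
  ℚ-ring = fromCommutativeRing ℚ.+-*-commutativeRing (λ x → dec⇒maybe (0ℚ ≟ x))

  toℚᵘ-ℕ→ℚ : ∀ n → toℚᵘ (ℕ→ℚ n) ℚᵘ.≃ ℚᵘ.mkℚᵘ (ℤ.+ n) 0
  toℚᵘ-ℕ→ℚ n = ℚ.toℚᵘ-fromℚᵘ (ℚᵘ.mkℚᵘ (ℤ.+ n) 0)

  ℕ→ℚ-+ : ∀ m n → ℕ→ℚ (m ℕ.+ n) ≡ ℕ→ℚ m + ℕ→ℚ n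
  ℕ→ℚ-+ m n = ℚ.toℚᵘ-injective
    (ℚᵘ.≃-trans (toℚᵘ-ℕ→ℚ (m ℕ.+ n))
    (ℚᵘ.≃-trans (ℚᵘ.*≡* (cong (ℤ._* ℤ.+ 1) (sym (cong₂ ℤ._+_ (ℤ.*-identityʳ (ℤ.+ m)) (ℤ.*-identityʳ (ℤ.+ n))))))
    (ℚᵘ.≃-trans (ℚᵘ.+-cong (ℚᵘ.≃-sym (toℚᵘ-ℕ→ℚ m)) (ℚᵘ.≃-sym (toℚᵘ-ℕ→ℚ n)))
    (ℚᵘ.≃-sym (ℚ.toℚᵘ-homo-+ (ℕ→ℚ m) (ℕ→ℚ n))))))

  ℕ→ℚ-* : ∀ m n → ℕ→ℚ (m ℕ.* n) ≡ ℕ→ℚ m * ℕ→ℚ n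
  ℕ→ℚ-* zero    n = sym (ℚ.*-zeroˡ (ℕ→ℚ n))
  ℕ→ℚ-* (suc m) n = begin
    ℕ→ℚ (n ℕ.+ m ℕ.* n)           ≡⟨ ℕ→ℚ-+ n (m ℕ.* n) ⟩
    ℕ→ℚ n + ℕ→ℚ (m ℕ.* n)         ≡⟨ cong (λ z → ℕ→ℚ n + z) (ℕ→ℚ-* m n) ⟩
    ℕ→ℚ n + ℕ→ℚ m * ℕ→ℚ n         ≡⟨ lem (ℕ→ℚ n) (ℕ→ℚ m) ⟩
    (1ℚ + ℕ→ℚ m) * ℕ→ℚ n          ≡⟨ cong (_* ℕ→ℚ n) (ℕ→ℚ-+ 1 m) ⟨
    ℕ→ℚ (suc m) * ℕ→ℚ n           ∎
    where
    lem : ∀ x y → x + y * x ≡ (1ℚ + y) * x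
    lem = solve-∀ ℚ-ring

  ℕ→ℚ-suc≢0 : ∀ n → ℕ→ℚ (suc n) ≢ 0ℚ
  ℕ→ℚ-suc≢0 n eq with ℚᵘ.≃-trans (ℚᵘ.≃-sym (toℚᵘ-ℕ→ℚ (suc n))) (ℚ.toℚᵘ-cong eq)
  ... | ℚᵘ.*≡* ()

  ℕ→ℚ-nonZero≢0 : ∀ n → .{{ℕ.NonZero n}} → ℕ→ℚ n ≢ 0ℚ
  ℕ→ℚ-nonZero≢0 (suc n) = ℕ→ℚ-suc≢0 n

  *-recip : ∀ x → x ≢ 0ℚ → x * recip x ≡ 1ℚ
  *-recip x x≢0 with x ≟ 0ℚ
  ... | yes x≡0 = contradiction x≡0 x≢0
  ... | no  x≢0′ = ℚ.*-inverseʳ x {{≢-nonZero x≢0′}}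

  recip-unique : ∀ x y → x ≢ 0ℚ → x * y ≡ 1ℚ → recip x ≡ y
  recip-unique x y x≢0 xy≡1 = begin
    recip x              ≡⟨ ℚ.*-identityʳ (recip x) ⟨
    recip x * 1ℚ         ≡⟨ cong (recip x *_) xy≡1 ⟨
    recip x * (x * y)    ≡⟨ lem (recip x) x y ⟩
    (x * recip x) * y    ≡⟨ cong (_* y) (*-recip x x≢0) ⟩
    1ℚ * y               ≡⟨ ℚ.*-identityˡ y ⟩
    y                    ∎
    where
    lem : ∀ r x y → r * (x * y) ≡ (x * r) * y
    lem = solve-∀ ℚ-ring

  *-nonZero : ∀ {x y} → x ≢ 0ℚ → y ≢ 0ℚ → x * y ≢ 0ℚ
  *-nonZero {x} {y} x≢0 y≢0 xy≡0 = y≢0 (begin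
    y                    ≡⟨ ℚ.*-identityˡ y ⟨
    1ℚ * y               ≡⟨ cong (_* y) (*-recip x x≢0) ⟨
    (x * recip x) * y    ≡⟨ lem (recip x) x y ⟩
    recip x * (x * y)    ≡⟨ cong (recip x *_) xy≡0 ⟩
    recip x * 0ℚ         ≡⟨ ℚ.*-zeroʳ (recip x) ⟩
    0ℚ                   ∎)
    where
    lem : ∀ r x y → (x * r) * y ≡ r * (x * y)
    lem = solve-∀ ℚ-ring

  recip-* : ∀ {x y} → x ≢ 0ℚ → y ≢ 0ℚ → recip (x * y) ≡ recip x * recip y
  recip-* {x} {y} x≢0 y≢0 = recip-unique (x * y) _ (*-nonZero x≢0 y≢0) (begin
    (x * y) * (recip x * recip y)   ≡⟨ lem x y (recip x) (recip y) ⟩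
    (x * recip x) * (y * recip y)   ≡⟨ cong₂ _*_ (*-recip x x≢0) (*-recip y y≢0) ⟩
    1ℚ * 1ℚ                         ≡⟨⟩
    1ℚ                              ∎)
    where
    lem : ∀ x y r s → (x * y) * (r * s) ≡ (x * r) * (y * s)
    lem = solve-∀ ℚ-ring

  sumℚ-++ : ∀ xs ys → sumℚ (xs ++ ys) ≡ sumℚ xs + sumℚ ys
  sumℚ-++ []       ys = sym (ℚ.+-identityˡ _)
  sumℚ-++ (x ∷ xs) ys = trans (cong (x +_) (sumℚ-++ xs ys)) (sym (ℚ.+-assoc x _ _))

  sumℚ-concatMap : ∀ {A B : Set} (g : B → ℚ) (h : A → List B) xs →
    sumℚ (map g (concatMap h xs)) ≡ sumℚ (map (λ x → sumℚ (map g (h x))) xs)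
  sumℚ-concatMap g h []       = refl
  sumℚ-concatMap g h (x ∷ xs) = begin
    sumℚ (map g (h x ++ concatMap h xs))            ≡⟨ cong sumℚ (map-++ g (h x) _) ⟩
    sumℚ (map g (h x) ++ map g (concatMap h xs))    ≡⟨ sumℚ-++ (map g (h x)) _ ⟩
    sumℚ (map g (h x)) + sumℚ (map g (concatMap h xs)) ≡⟨ cong (sumℚ (map g (h x)) +_) (sumℚ-concatMap g h xs) ⟩
    sumℚ (map g (h x)) + sumℚ (map (λ x → sumℚ (map g (h x))) xs) ∎

  sumℚ-*ˡ : ∀ {A : Set} c (f : A → ℚ) xs → sumℚ (map (λ x → c * f x) xs) ≡ c * sumℚ (map f xs)
  sumℚ-*ˡ c f []       = sym (ℚ.*-zeroʳ c)
  sumℚ-*ˡ c f (x ∷ xs) = trans (cong (c * f x +_) (sumℚ-*ˡ c f xs)) (sym (ℚ.*-distribˡ-+ c (f x) (sumℚ (map f xs))))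

  sumℚ-tabulate : ∀ {A : Set} {n} (f : A → ℚ) (g : Fin n → A) → sumℚ (map f (tabulate g)) ≡ sum (f ∘ g)
  sumℚ-tabulate {n = zero}  f g = refl
  sumℚ-tabulate {n = suc n} f g = cong (f (g Fin.zero) +_) (sumℚ-tabulate f (g ∘ Fin.suc))

  sumℚ-applyUpTo : ∀ {A : Set} (f : A → ℚ) (g : ℕ → A) n → sumℚ (map f (applyUpTo g n)) ≡ sum {n} (λ i → f (g (toℕ i)))
  sumℚ-applyUpTo f g zero    = refl
  sumℚ-applyUpTo f g (suc n) = cong (f (g 0) +_) (sumℚ-applyUpTo f (g ∘ suc) n)

  sum-snoc : ∀ n (h : ℕ → ℚ) → sum {suc n} (h ∘ toℕ) ≡ sum {n} (h ∘ toℕ) + h n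
  sum-snoc zero    h = ℚ.+-comm (h 0) 0ℚ
  sum-snoc (suc n) h = trans (cong (h 0 +_) (sum-snoc n (h ∘ suc))) (sym (ℚ.+-assoc (h 0) _ _))

  -- Defined by the Leibniz rule; leibniz-closed identifies it as a binomial convolution.
  leibniz : ℕ → (ℕ → ℕ → ℚ) → ℚ
  leibniz zero    F = F 0 0
  leibniz (suc r) F = leibniz r (λ i j → F (suc i) j) + leibniz r (λ i j → F i (suc j))

  leibniz-cong : ∀ r {F G} → (∀ i j → F i j ≡ G i j) → leibniz r F ≡ leibniz r G
  leibniz-cong zero    F≗G = F≗G 0 0
  leibniz-cong (suc r) F≗G = cong₂ _+_ (leibniz-cong r (λ i j → F≗G (suc i) j)) (leibniz-cong r (λ i j → F≗G i (suc j)))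

  leibniz-+ : ∀ r F G → leibniz r (λ i j → F i j + G i j) ≡ leibniz r F + leibniz r G
  leibniz-+ zero    F G = refl
  leibniz-+ (suc r) F G = trans (cong₂ _+_ (leibniz-+ r _ _) (leibniz-+ r _ _))
    (lem (leibniz r _) (leibniz r _) (leibniz r _) (leibniz r _))
    where
    lem : ∀ a b c d → (a + b) + (c + d) ≡ (a + c) + (b + d)
    lem = solve-∀ ℚ-ring

  leibniz-0 : ∀ r → leibniz r (λ _ _ → 0ℚ) ≡ 0ℚ
  leibniz-0 zero    = refl
  leibniz-0 (suc r) = cong₂ _+_ (leibniz-0 r) (leibniz-0 r)

  leibniz-* : ∀ r c F → leibniz r (λ i j → c * F i j) ≡ c * leibniz r F
  leibniz-* zero    c F = refl
  leibniz-* (suc r) c F = trans (cong₂ _+_ (leibniz-* r c _) (leibniz-* r c _)) (sym (ℚ.*-distribˡ-+ c _ _))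

  leibniz-sum : ∀ r {n} (F : Fin n → ℕ → ℕ → ℚ) →
    leibniz r (λ i j → sum (λ x → F x i j)) ≡ sum (λ x → leibniz r (F x))
  leibniz-sum r {zero}  F = leibniz-0 r
  leibniz-sum r {suc n} F = trans (leibniz-+ r (F Fin.zero) (λ i j → sum (λ x → F (Fin.suc x) i j)))
    (cong (leibniz r (F Fin.zero) +_) (leibniz-sum r (F ∘ Fin.suc)))

  -- Pascal's rule. The half that raises `j` is padded with the vanishing term at index `suc r`;
  -- once its term at index 0 is split off, both halves run over the same values of `F` and their
  -- coefficients add up.
  leibniz-closed : ∀ r F → leibniz r F ≡ sum {suc r} (λ i → ℕ→ℚ (r C toℕ i) * F (toℕ i) (r ∸ toℕ i))
  leibniz-closed zero    F = sym (trans (ℚ.+-identityʳ _) (ℚ.*-identityˡ _))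
  leibniz-closed (suc r) F = begin
    leibniz r (λ i j → F (suc i) j) + leibniz r (λ i j → F i (suc j))
      ≡⟨ cong₂ _+_ (leibniz-closed r _) (leibniz-closed r _) ⟩
    sum {suc r} (λ i → c (toℕ i) * F (suc (toℕ i)) (r ∸ toℕ i)) +
    sum {suc r} (λ i → c (toℕ i) * F (toℕ i) (suc (r ∸ toℕ i)))
      ≡⟨ cong (S +_) (trans (sum-cong-≗ {suc r} shift) (sym extend)) ⟩
    S + sum {suc (suc r)} (λ i → c (toℕ i) * F (toℕ i) (suc r ∸ toℕ i))
      ≡⟨ lem S (c 0 * F 0 (suc r)) S′ ⟩
    c 0 * F 0 (suc r) +
    (S + S′)
      ≡⟨ cong (c 0 * F 0 (suc r) +_) (trans (sym (∑-distrib-+ f f′)) (sum-cong-≗ {suc r} pascal)) ⟩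
    sum {suc (suc r)} (λ i → ℕ→ℚ (suc r C toℕ i) * F (toℕ i) (suc r ∸ toℕ i)) ∎
    where
    c : ℕ → ℚ
    c i = ℕ→ℚ (r C i)
    f f′ : Fin (suc r) → ℚ
    f  i = c (toℕ i) * F (suc (toℕ i)) (r ∸ toℕ i)
    f′ i = c (suc (toℕ i)) * F (suc (toℕ i)) (r ∸ toℕ i)
    S = sum f
    S′ = sum f′
    shift : ∀ (i : Fin (suc r)) → c (toℕ i) * F (toℕ i) (suc (r ∸ toℕ i)) ≡ c (toℕ i) * F (toℕ i) (suc r ∸ toℕ i)
    shift i = cong (λ z → c (toℕ i) * F (toℕ i) z) (sym (ℕ.+-∸-assoc 1 (ℕ.≤-pred (toℕ<n i))))
    extend : sum {suc (suc r)} (λ i → c (toℕ i) * F (toℕ i) (suc r ∸ toℕ i)) ≡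
             sum {suc r} (λ i → c (toℕ i) * F (toℕ i) (suc r ∸ toℕ i))
    extend = begin
      sum {suc (suc r)} (g ∘ toℕ)              ≡⟨ sum-snoc (suc r) g ⟩
      G + c (suc r) * F (suc r) (r ∸ r)        ≡⟨ cong (λ z → G + ℕ→ℚ z * F (suc r) (r ∸ r)) (k>n⇒nCk≡0 (ℕ.n<1+n r)) ⟩
      G + 0ℚ * F (suc r) (r ∸ r)               ≡⟨ cong (G +_) (ℚ.*-zeroˡ (F (suc r) (r ∸ r))) ⟩
      G + 0ℚ                                   ≡⟨ ℚ.+-identityʳ G ⟩
      G                                        ∎
      where
      g : ℕ → ℚ
      g i = c i * F i (suc r ∸ i)
      G = sum {suc r} (g ∘ toℕ)
    lem : ∀ x y z → x + (y + z) ≡ y + (x + z)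
    lem = solve-∀ ℚ-ring
    pascal : ∀ (i : Fin (suc r)) →
      c (toℕ i) * F (suc (toℕ i)) (r ∸ toℕ i) + c (suc (toℕ i)) * F (suc (toℕ i)) (r ∸ toℕ i) ≡
      ℕ→ℚ (suc r C suc (toℕ i)) * F (suc (toℕ i)) (r ∸ toℕ i)
    pascal i = trans (sym (ℚ.*-distribʳ-+ (F (suc (toℕ i)) (r ∸ toℕ i)) (c (toℕ i)) (c (suc (toℕ i)))))
      (cong (_* F (suc (toℕ i)) (r ∸ toℕ i))
        (trans (sym (ℕ→ℚ-+ (r C toℕ i) _)) (cong ℕ→ℚ (nCk+nC[k+1]≡[n+1]C[k+1] r (toℕ i)))))

  -- The inner sum of `Nr` with arbitrary weights: r! times the coefficient of t ^ r in the product
  -- of the exponential generating functions of the `w i`. In this reading, raising `r` by one is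
  -- differentiation.
  multinomialSum : ∀ {b} → (Fin b → ℕ → ℚ) → ℕ → ℚ
  multinomialSum {b} w r =
    sumℚ (map (λ rs → multinomial r rs * prodℚ (map (λ i → w i (lookup rs i)) (allFin b))) (compositions b r))

  prodFact : ∀ {b} → Vec ℕ b → ℚ
  prodFact rs = prodℚ (map (λ x → ℕ→ℚ (x !)) (toList rs))

  !≢0 : ∀ n → ℕ→ℚ (n !) ≢ 0ℚ
  !≢0 n = ℕ→ℚ-nonZero≢0 (n !) {{n ℕ.!≢0}}

  prodFact≢0 : ∀ {b} (rs : Vec ℕ b) → prodFact rs ≢ 0ℚ
  prodFact≢0 []       = ℕ→ℚ-suc≢0 0
  prodFact≢0 (r ∷ rs) = *-nonZero (!≢0 r) (prodFact≢0 rs)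

  multinomial-∷ : ∀ {b r j} (rs : Vec ℕ b) → j ℕ.≤ r →
    multinomial r (j ∷ rs) ≡ ℕ→ℚ (r C j) * multinomial (r ∸ j) rs
  multinomial-∷ {b} {r} {j} rs j≤r = begin
    ℕ→ℚ (r !) * recip (ℕ→ℚ (j !) * prodFact rs)
      ≡⟨ cong₂ _*_ r!≡ (recip-* (!≢0 j) (prodFact≢0 rs)) ⟩
    (B * (F * S)) * (recip F * recip X)
      ≡⟨ lem B F S (recip F) (recip X) ⟩
    (F * recip F) * (B * (S * recip X))
      ≡⟨ cong (_* (B * (S * recip X))) (*-recip F (!≢0 j)) ⟩
    1ℚ * (B * (S * recip X)) ≡⟨ ℚ.*-identityˡ _ ⟩
    _ ∎
    where
    B = ℕ→ℚ (r C j)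
    F = ℕ→ℚ (j !)
    S = ℕ→ℚ ((r ∸ j) !)
    X = prodFact rs
    r!≡ : ℕ→ℚ (r !) ≡ B * (F * S)
    r!≡ = begin
      ℕ→ℚ (r !) ≡⟨ cong ℕ→ℚ (nCk*k!*[n∸k]!≡n! j≤r) ⟨
      ℕ→ℚ ((r C j) ℕ.* (j ! ℕ.* (r ∸ j) !)) ≡⟨ ℕ→ℚ-* (r C j) _ ⟩
      B * ℕ→ℚ (j ! ℕ.* (r ∸ j) !) ≡⟨ cong (B *_) (ℕ→ℚ-* (j !) _) ⟩
      B * (F * S) ∎
    lem : ∀ c j s j′ x → (c * (j * s)) * (j′ * x) ≡ (j * j′) * (c * (s * x))
    lem = solve-∀ ℚ-ring

  -- Group the compositions by their first part j: the multinomial coefficient factors as `r C j`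
  -- times the one for the remaining parts, and what results is the closed form of `leibniz`.
  multinomialSum-∷ : ∀ {b} (w : Fin (suc b) → ℕ → ℚ) r →
    multinomialSum w r ≡ leibniz r (λ i j → w Fin.zero i * multinomialSum (w ∘ Fin.suc) j)
  multinomialSum-∷ {b} w r = begin
    multinomialSum w r
      ≡⟨ sumℚ-concatMap t (λ j → map (j ∷_) (compositions b (r ∸ j))) (upTo (suc r)) ⟩
    sumℚ (map (λ j → sumℚ (map t (map (j ∷_) (compositions b (r ∸ j))))) (upTo (suc r)))
      ≡⟨ sumℚ-applyUpTo (λ j → sumℚ (map t (map (j ∷_) (compositions b (r ∸ j))))) id (suc r) ⟩
    sum {suc r} (λ i → sumℚ (map t (map (toℕ i ∷_) (compositions b (r ∸ toℕ i)))))
      ≡⟨ sum-cong-≗ {suc r} (λ i → inner (toℕ i) (ℕ.≤-pred (toℕ<n i))) ⟩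
    sum {suc r} (λ i → ℕ→ℚ (r C toℕ i) * (w Fin.zero (toℕ i) * multinomialSum (w ∘ Fin.suc) (r ∸ toℕ i)))
      ≡⟨ leibniz-closed r _ ⟨
    _ ∎
    where
    t : Vec ℕ (suc b) → ℚ
    t rs = multinomial r rs * prodℚ (map (λ i → w i (lookup rs i)) (allFin (suc b)))
    u : ℕ → Vec ℕ b → ℚ
    u j rs = multinomial (r ∸ j) rs * prodℚ (map (λ i → w (Fin.suc i) (lookup rs i)) (allFin b))
    lem : ∀ c m x p → (c * m) * (x * p) ≡ (c * x) * (m * p)
    lem = solve-∀ ℚ-ring
    term : ∀ j → j ℕ.≤ r → ∀ rs → t (j ∷ rs) ≡ (ℕ→ℚ (r C j) * w Fin.zero j) * u j rs
    term j j≤r rs = begin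
      multinomial r (j ∷ rs) * (w Fin.zero j * prodℚ (map (λ i → w i (lookup (j ∷ rs) i)) (tabulate Fin.suc)))
        ≡⟨ cong₂ _*_ (multinomial-∷ rs j≤r) (cong (λ z → w Fin.zero j * prodℚ z)
             (trans (map-tabulate Fin.suc (λ i → w i (lookup (j ∷ rs) i)))
                    (sym (map-tabulate id (λ i → w (Fin.suc i) (lookup rs i)))))) ⟩
      (ℕ→ℚ (r C j) * multinomial (r ∸ j) rs) * (w Fin.zero j * prodℚ (map (λ i → w (Fin.suc i) (lookup rs i)) (allFin b)))
        ≡⟨ lem (ℕ→ℚ (r C j)) (multinomial (r ∸ j) rs) (w Fin.zero j) _ ⟩
      _ ∎
    inner : ∀ j → j ℕ.≤ r → sumℚ (map t (map (j ∷_) (compositions b (r ∸ j)))) ≡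
      ℕ→ℚ (r C j) * (w Fin.zero j * multinomialSum (w ∘ Fin.suc) (r ∸ j))
    inner j j≤r = begin
      sumℚ (map t (map (j ∷_) (compositions b (r ∸ j))))
        ≡⟨ cong sumℚ (sym (map-∘ (compositions b (r ∸ j)))) ⟩
      sumℚ (map (λ rs → t (j ∷ rs)) (compositions b (r ∸ j)))
        ≡⟨ cong sumℚ (map-cong (term j j≤r) (compositions b (r ∸ j))) ⟩
      sumℚ (map (λ rs → (ℕ→ℚ (r C j) * w Fin.zero j) * u j rs) (compositions b (r ∸ j)))
        ≡⟨ sumℚ-*ˡ (ℕ→ℚ (r C j) * w Fin.zero j) (u j) (compositions b (r ∸ j)) ⟩
      (ℕ→ℚ (r C j) * w Fin.zero j) * multinomialSum (w ∘ Fin.suc) (r ∸ j)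
        ≡⟨ ℚ.*-assoc (ℕ→ℚ (r C j)) (w Fin.zero j) _ ⟩
      _ ∎

  module _ {x} {X : Set x} {n} (shift : Fin n → X → X) (W : X → ℕ → ℚ)
           (W-suc : ∀ y r → W y (suc r) ≡ sum (λ l → W (shift l y) r)) where

    -- The product rule: the derivative of a product differentiates one factor at a time, and by
    -- `W-suc` differentiating factor i means summing over the shifts of `y i`. Unfolding
    -- `leibniz (suc r)` separates the head factor from the tail, to which the induction applies.
    multinomialSum-suc : ∀ {b} (y : Fin b → X) r →
      multinomialSum (W ∘ y) (suc r) ≡
      sum (λ i → sum (λ l → multinomialSum (W ∘ updateAt y i (shift l)) r))
    multinomialSum-suc {zero}  y r = refl
    multinomialSum-suc {suc b} y r = begin
      multinomialSum (W ∘ y) (suc r)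
        ≡⟨ multinomialSum-∷ (W ∘ y) (suc r) ⟩
      leibniz r (λ i j → W y₀ (suc i) * T j) + leibniz r (λ i j → W y₀ i * T (suc j))
        ≡⟨ cong₂ _+_ headPart tailPart ⟩
      _ ∎
      where
      y₀ = y Fin.zero
      T = multinomialSum (W ∘ y ∘ Fin.suc)
      headPart : leibniz r (λ i j → W y₀ (suc i) * T j) ≡
                 sum (λ l → multinomialSum (W ∘ updateAt y Fin.zero (shift l)) r)
      headPart = begin
        _ ≡⟨ leibniz-cong r (λ i j → begin
               W y₀ (suc i) * T j ≡⟨ ℚ.*-comm (W y₀ (suc i)) (T j) ⟩
               T j * W y₀ (suc i) ≡⟨ cong (T j *_) (W-suc y₀ i) ⟩
               T j * sum (λ l → W (shift l y₀) i) ≡⟨ *-distribˡ-sum (T j) (λ l → W (shift l y₀) i) ⟩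
               sum (λ l → T j * W (shift l y₀) i) ≡⟨ sum-cong-≗ (λ l → ℚ.*-comm (T j) (W (shift l y₀) i)) ⟩
               sum (λ l → W (shift l y₀) i * T j) ∎) ⟩
        leibniz r (λ i j → sum (λ l → W (shift l y₀) i * T j))
          ≡⟨ leibniz-sum r (λ l i j → W (shift l y₀) i * T j) ⟩
        sum (λ l → leibniz r (λ i j → W (shift l y₀) i * T j))
          ≡⟨ sum-cong-≗ (λ l → sym (multinomialSum-∷ (W ∘ updateAt y Fin.zero (shift l)) r)) ⟩
        _ ∎
      tailPart : leibniz r (λ i j → W y₀ i * T (suc j)) ≡
        sum (λ i → sum (λ l → multinomialSum (W ∘ updateAt y (Fin.suc i) (shift l)) r))
      tailPart = begin
        _ ≡⟨ leibniz-cong r (λ i j → begin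
               W y₀ i * T (suc j) ≡⟨ cong (W y₀ i *_) (multinomialSum-suc (y ∘ Fin.suc) j) ⟩
               W y₀ i * sum (λ h → sum (λ l → T′ h l j))
                 ≡⟨ *-distribˡ-sum (W y₀ i) (λ h → sum (λ l → T′ h l j)) ⟩
               sum (λ h → W y₀ i * sum (λ l → T′ h l j))
                 ≡⟨ sum-cong-≗ (λ h → *-distribˡ-sum (W y₀ i) (λ l → T′ h l j)) ⟩
               sum (λ h → sum (λ l → W y₀ i * T′ h l j)) ∎) ⟩
        leibniz r (λ i j → sum (λ h → sum (λ l → W y₀ i * T′ h l j)))
          ≡⟨ leibniz-sum r (λ h i j → sum (λ l → W y₀ i * T′ h l j)) ⟩
        sum (λ h → leibniz r (λ i j → sum (λ l → W y₀ i * T′ h l j)))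
          ≡⟨ sum-cong-≗ (λ h → leibniz-sum r (λ l i j → W y₀ i * T′ h l j)) ⟩
        sum (λ h → sum (λ l → leibniz r (λ i j → W y₀ i * T′ h l j)))
          ≡⟨ sum-cong-≗ (λ h → sum-cong-≗ (λ l → sym (multinomialSum-∷ (W ∘ updateAt y (Fin.suc h) (shift l)) r))) ⟩
        _ ∎
        where
        T′ : Fin b → Fin n → ℕ → ℚ
        T′ h l = multinomialSum (W ∘ updateAt (y ∘ Fin.suc) h (shift l))

  sum-+ : ∀ m n (f : Fin (m ℕ.+ n) → ℚ) → sum f ≡ sum (λ i → f (i ↑ˡ n)) ℚ.+ sum (λ j → f (m ↑ʳ j))
  sum-+ zero    n f = ≡.sym (ℚ.+-identityˡ (sum f))
  sum-+ (suc m) n f = ≡.trans (≡.cong (f Fin.zero ℚ.+_) (sum-+ m n (f ∘ Fin.suc)))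
    (≡.sym (ℚ.+-assoc (f Fin.zero) (sum (λ i → f (Fin.suc (i ↑ˡ n)))) (sum (λ j → f (Fin.suc (m ↑ʳ j))))))

  sum-combine : ∀ m n (f : Fin (m ℕ.* n) → ℚ) → sum f ≡ sum (λ i → sum (λ j → f (combine {m} {n} i j)))
  sum-combine zero    n f = ≡.refl
  sum-combine (suc m) n f = ≡.trans (sum-+ n (m ℕ.* n) f)
    (≡.cong (sum (λ i → f (i ↑ˡ (m ℕ.* n))) ℚ.+_) (sum-combine m n (λ j → f (n ↑ʳ j))))

  -- At `r = 0` the zero vector is the only composition, so the sum is the product of the `w i 0`.
  -- This lemma and the next one serve to evaluate N_0.
  multinomialSum-zero-one : ∀ {b} (w : Fin b → ℕ → ℚ) → (∀ i → w i 0 ≡ 1ℚ) → multinomialSum w 0 ≡ 1ℚ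
  multinomialSum-zero-one {zero}  w _   = ≡.refl
  multinomialSum-zero-one {suc b} w w≡1 = ≡.trans (multinomialSum-∷ w 0)
    (≡.cong₂ ℚ._*_ (w≡1 Fin.zero) (multinomialSum-zero-one (w ∘ Fin.suc) (w≡1 ∘ Fin.suc)))

  multinomialSum-zero-zero : ∀ {b} (w : Fin b → ℕ → ℚ) i → w i 0 ≡ 0ℚ → multinomialSum w 0 ≡ 0ℚ
  multinomialSum-zero-zero {suc b} w Fin.zero w≡0 = ≡.trans (multinomialSum-∷ w 0)
    (≡.trans (≡.cong (ℚ._* multinomialSum (w ∘ Fin.suc) 0) w≡0) (ℚ.*-zeroˡ (multinomialSum (w ∘ Fin.suc) 0)))
  multinomialSum-zero-zero {suc b} w (Fin.suc i) w≡0 = ≡.trans (multinomialSum-∷ w 0)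
    (≡.trans (≡.cong (w Fin.zero 0 ℚ.*_) (multinomialSum-zero-zero (w ∘ Fin.suc) i w≡0)) (ℚ.*-zeroʳ (w Fin.zero 0)))

  sum-const : ∀ n x → sum {n} (λ _ → x) ≡ ℕ→ℚ n * x
  sum-const zero    x = sym (ℚ.*-zeroˡ x)
  sum-const (suc n) x = begin
    x + sum {n} (λ _ → x)      ≡⟨ cong (x +_) (sum-const n x) ⟩
    x + ℕ→ℚ n * x              ≡⟨ lem x (ℕ→ℚ n) ⟩
    (1ℚ + ℕ→ℚ n) * x           ≡⟨ cong (_* x) (ℕ→ℚ-+ 1 n) ⟨
    ℕ→ℚ (suc n) * x            ∎
    where
    lem : ∀ x y → x + y * x ≡ (1ℚ + y) * x
    lem = solve-∀ ℚ-ring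

  -- The weights a_i in a single coordinate, with Q = m + 2

  module _ (m : ℕ) where

    private
      Q = suc (suc m)
      x = ℕ→ℚ Q - 1ℚ
      ρ = recip (ℕ→ℚ Q)
      -- The two branches of `aCoeff`. In the field of order Q they count the r-tuples of units
      -- whose sum is 0 (`A`) or a fixed nonzero element (`B`); `x` is the number of units.
      A B : ℕ → ℚ
      A r = (x * ρ) * (powPred x r - powPred (- 1ℚ) r)
      B r = ρ * (powℚ x r - powℚ (- 1ℚ) r)

      x≡1+m : x ≡ ℕ→ℚ (suc m)
      x≡1+m = begin
        ℕ→ℚ Q - 1ℚ                   ≡⟨ cong (_- 1ℚ) (ℕ→ℚ-+ 1 (suc m)) ⟩
        (1ℚ + ℕ→ℚ (suc m)) - 1ℚ      ≡⟨ lem (ℕ→ℚ (suc m)) ⟩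
        ℕ→ℚ (suc m)                  ∎
        where
        lem : ∀ y → (1ℚ + y) - 1ℚ ≡ y
        lem = solve-∀ ℚ-ring

      x≢0 : x ≢ 0ℚ
      x≢0 = subst (_≢ 0ℚ) (sym x≡1+m) (ℕ→ℚ-suc≢0 m)

      [x+1]ρ≡1 : (x + 1ℚ) * ρ ≡ 1ℚ
      [x+1]ρ≡1 = trans (cong (_* ρ) (lem (ℕ→ℚ Q))) (*-recip (ℕ→ℚ Q) (ℕ→ℚ-suc≢0 (suc m)))
        where
        lem : ∀ y → (y - 1ℚ) + 1ℚ ≡ y
        lem = solve-∀ ℚ-ring

      -- The exponent -1 occurs here: `recip (- 1ℚ)` computes to `- 1ℚ`, so the difference of powers
      -- is 1/x + 1 = Q/x, which cancels the factor x/Q.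
      A-zero : A 0 ≡ 1ℚ
      A-zero = begin
        (x * ρ) * (recip x - - 1ℚ)        ≡⟨ lem x ρ (recip x) ⟩
        ρ * (x * recip x + x)             ≡⟨ cong (λ z → ρ * (z + x)) (*-recip x x≢0) ⟩
        ρ * (1ℚ + x)                      ≡⟨ lem₂ ρ x ⟩
        (x + 1ℚ) * ρ                      ≡⟨ [x+1]ρ≡1 ⟩
        1ℚ                                ∎
        where
        lem : ∀ x ρ y → (x * ρ) * (y - - 1ℚ) ≡ ρ * (x * y + x)
        lem = solve-∀ ℚ-ring
        lem₂ : ∀ ρ x → ρ * (1ℚ + x) ≡ (x + 1ℚ) * ρ
        lem₂ = solve-∀ ℚ-ring

      B-zero : B 0 ≡ 0ℚ
      B-zero = ℚ.*-zeroʳ ρ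

      A-suc : ∀ r → A (suc r) ≡ x * B r
      A-suc r = ℚ.*-assoc x ρ (powℚ x r - powℚ (- 1ℚ) r)

      -- In terms of tuples: one chosen unit either equals the target and leaves 0, or is one of the
      -- Q - 2 others and leaves a nonzero target.
      B-suc : ∀ r → B (suc r) ≡ A r + (x - 1ℚ) * B r
      -- `A 0` contains a reciprocal, so this case is not the polynomial identity that settles
      -- `suc r`; both sides equal 1.
      B-suc zero = begin
        ρ * (x * 1ℚ - (- 1ℚ) * 1ℚ)     ≡⟨ lem ρ x ⟩
        (x + 1ℚ) * ρ                   ≡⟨ [x+1]ρ≡1 ⟩
        1ℚ                             ≡⟨ A-zero ⟨
        A 0                            ≡⟨ lem₂ (A 0) (x - 1ℚ) ⟩
        A 0 + (x - 1ℚ) * 0ℚ            ≡⟨ cong (λ z → A 0 + (x - 1ℚ) * z) B-zero ⟨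
        A 0 + (x - 1ℚ) * B 0           ∎
        where
        lem : ∀ ρ x → ρ * (x * 1ℚ - (- 1ℚ) * 1ℚ) ≡ (x + 1ℚ) * ρ
        lem = solve-∀ ℚ-ring
        lem₂ : ∀ a y → a ≡ a + y * 0ℚ
        lem₂ = solve-∀ ℚ-ring
      B-suc (suc r) = lem ρ x (powℚ x r) (powℚ (- 1ℚ) r)
        where
        lem : ∀ ρ x p e → ρ * (x * (x * p) - (- 1ℚ) * ((- 1ℚ) * e)) ≡
                          (x * ρ) * (p - e) + (x - 1ℚ) * (ρ * (x * p - (- 1ℚ) * e))
        lem = solve-∀ ℚ-ring

    aCoeff-true : ∀ {z} {Z : Set z} (dZ : Dec Z) → Z → ∀ r → aCoeff Q Z dZ r ≡ A r
    aCoeff-true (yes _) h r = refl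
    aCoeff-true (no ¬h) h r = contradiction h ¬h

    aCoeff-false : ∀ {z} {Z : Set z} (dZ : Dec Z) → ¬ Z → ∀ r → aCoeff Q Z dZ r ≡ B r
    aCoeff-false (yes h) ¬h r = contradiction h ¬h
    aCoeff-false (no _)  ¬h r = refl

    aCoeff-zero-true : ∀ {z} {Z : Set z} (dZ : Dec Z) → Z → aCoeff Q Z dZ 0 ≡ 1ℚ
    aCoeff-zero-true dZ h = trans (aCoeff-true dZ h 0) A-zero

    aCoeff-zero-false : ∀ {z} {Z : Set z} (dZ : Dec Z) → ¬ Z → aCoeff Q Z dZ 0 ≡ 0ℚ
    aCoeff-zero-false dZ ¬h = trans (aCoeff-false dZ ¬h 0) B-zero

    -- All that matters about the field is how many of the Q - 1 shifts reach zero: none when the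
    -- coordinate is zero, exactly one otherwise. These two cases are the recurrences of `A` and
    -- `B`.
    aCoeff-suc : ∀ {z} {Z : Set z} (dZ : Dec Z) {Z′ : Fin (suc m) → Set z} (dZ′ : ∀ l → Dec (Z′ l)) →
      (Z → ∀ l → ¬ Z′ l) → (¬ Z → ∃ λ l₀ → Z′ l₀ × (∀ l → Z′ l → l ≡ l₀)) →
      ∀ r → aCoeff Q Z dZ (suc r) ≡ sum (λ l → aCoeff Q (Z′ l) (dZ′ l) r)
    aCoeff-suc {Z = Z} dZ {Z′} dZ′ zeroCase nonzeroCase r = byCases dZ
      where
      t : Fin (suc m) → ℚ
      t l = aCoeff Q (Z′ l) (dZ′ l) r
      byCases : Dec Z → aCoeff Q Z dZ (suc r) ≡ sum t
      byCases (yes h) = begin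
        aCoeff Q Z dZ (suc r)      ≡⟨ aCoeff-true dZ h (suc r) ⟩
        A (suc r)                  ≡⟨ A-suc r ⟩
        x * B r                    ≡⟨ cong (_* B r) x≡1+m ⟩
        ℕ→ℚ (suc m) * B r          ≡⟨ sum-const (suc m) (B r) ⟨
        sum {suc m} (λ _ → B r)    ≡⟨ sum-cong-≗ (λ l → sym (aCoeff-false (dZ′ l) (zeroCase h l) r)) ⟩
        sum t                      ∎
      byCases (no ¬h) with l₀ , z₀ , uniq ← nonzeroCase ¬h = begin
        aCoeff Q Z dZ (suc r)      ≡⟨ aCoeff-false dZ ¬h (suc r) ⟩
        B (suc r)                  ≡⟨ B-suc r ⟩
        A r + (x - 1ℚ) * B r       ≡⟨ cong (λ y → A r + y * B r) x-1≡m ⟩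
        A r + ℕ→ℚ m * B r          ≡⟨ cong (A r +_) (sum-const m (B r)) ⟨
        A r + sum {m} (λ _ → B r)
          ≡⟨ cong₂ _+_ (aCoeff-true (dZ′ l₀) z₀ r)
               (sum-cong-≗ (λ j → aCoeff-false (dZ′ (punchIn l₀ j)) (λ zj → punchInᵢ≢i l₀ j (uniq _ zj)) r)) ⟨
        t l₀ + sum (λ j → t (punchIn l₀ j))   ≡⟨ sum-remove {i = l₀} t ⟨
        sum t                      ∎
        where
        x-1≡m : x - 1ℚ ≡ ℕ→ℚ m
        x-1≡m = trans (cong (_- 1ℚ) (trans x≡1+m (ℕ→ℚ-+ 1 m))) (lem (ℕ→ℚ m))
          where
          lem : ∀ y → (1ℚ + y) - 1ℚ ≡ y
          lem = solve-∀ ℚ-ring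

  -- Counting solutions by splitting off one variable

  length-filter-map : ∀ {a b p} {A : Set a} {B : Set b} {P : B → Set p} (P? : Decidable P) (g : A → B) xs →
    length (filter P? (map g xs)) ≡ length (filter (P? ∘ g) xs)
  length-filter-map P? g []       = refl
  length-filter-map P? g (x ∷ xs) with does (P? (g x))
  ... | true  = cong suc (length-filter-map P? g xs)
  ... | false = length-filter-map P? g xs

  length-filter-concatMap : ∀ {a b p} {A : Set a} {B : Set b} {P : B → Set p} (P? : Decidable P) (h : A → List B) xs →
    ℕ→ℚ (length (filter P? (concatMap h xs))) ≡ sumℚ (map (λ x → ℕ→ℚ (length (filter P? (h x)))) xs)
  length-filter-concatMap P? h []       = refl
  length-filter-concatMap P? h (x ∷ xs) = begin
    ℕ→ℚ (length (filter P? (h x ++ concatMap h xs)))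
      ≡⟨ cong (ℕ→ℚ ∘ length) (filter-++ P? (h x) (concatMap h xs)) ⟩
    ℕ→ℚ (length (filter P? (h x) ++ filter P? (concatMap h xs)))
      ≡⟨ cong ℕ→ℚ (length-++ (filter P? (h x))) ⟩
    ℕ→ℚ (length (filter P? (h x)) ℕ.+ length (filter P? (concatMap h xs)))
      ≡⟨ ℕ→ℚ-+ (length (filter P? (h x))) (length (filter P? (concatMap h xs))) ⟩
    ℕ→ℚ (length (filter P? (h x))) + ℕ→ℚ (length (filter P? (concatMap h xs)))
      ≡⟨ cong (ℕ→ℚ (length (filter P? (h x))) +_) (length-filter-concatMap P? h xs) ⟩
    sumℚ (map (λ x → ℕ→ℚ (length (filter P? (h x)))) (x ∷ xs)) ∎

  module MsProperties {c ℓ} (R : CommutativeRing c ℓ) (dec : IsFieldDec R) {q} (fin : FiniteOfOrder R q) where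
    private module R = CommutativeRing R
    open R using (Carrier; _≈_; 0#)
    open IsFieldDec dec
    open FiniteOfOrder fin
    open FieldOps R
    open Counting R dec fin
    open import Algebra.Properties.AbelianGroup R.+-abelianGroup using (xyx⁻¹≈y)

    Ms-cong : ∀ k s {α β} → α ≈ β → Ms k s α ≡ Ms k s β
    Ms-cong k s α≈β = cong length (filter-≐ _ _ ((λ e → R.trans e α≈β) , (λ e → R.trans e (R.sym α≈β))) (allVecs q s))

    Ms-zero-true : ∀ k {α} → α ≈ 0# → Ms k 0 α ≡ 1
    Ms-zero-true k {α} α≈0 with 0# ≈? α
    ... | yes _ = refl
    ... | no 0≉α = contradiction (R.sym α≈0) 0≉α

    Ms-zero-false : ∀ k {α} → ¬ α ≈ 0# → Ms k 0 α ≡ 0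
    Ms-zero-false k {α} α≉0 with 0# ≈? α
    ... | yes 0≈α = contradiction (R.sym 0≈α) α≉0
    ... | no _ = refl

    Ms-suc : ∀ k s α → ℕ→ℚ (Ms k (suc s) α) ≡ sum (λ i → ℕ→ℚ (Ms k s (α R.- pow (enum i) k)))
    Ms-suc k s α = begin
      ℕ→ℚ (Ms k (suc s) α)
        ≡⟨ length-filter-concatMap P? (λ i → map (i ∷_) (allVecs q s)) (allFin q) ⟩
      sumℚ (map (λ i → ℕ→ℚ (length (filter P? (map (i ∷_) (allVecs q s))))) (allFin q))
        ≡⟨ sumℚ-tabulate (λ i → ℕ→ℚ (length (filter P? (map (i ∷_) (allVecs q s))))) id ⟩
      sum (λ i → ℕ→ℚ (length (filter P? (map (i ∷_) (allVecs q s)))))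
        ≡⟨ sum-cong-≗ (λ i → cong ℕ→ℚ (trans (length-filter-map P? (i ∷_) (allVecs q s))
             (cong length (filter-≐ _ _ (move {pow (enum i) k} , moveBack {pow (enum i) k}) (allVecs q s))))) ⟩
      sum (λ i → ℕ→ℚ (Ms k s (α R.- pow (enum i) k))) ∎
      where
      P? : Decidable (λ (v : Vec (Fin q) (suc s)) → sumF (suc s) (λ i → pow (enum (lookup v i)) k) ≈ α)
      P? v = sumF (suc s) (λ i → pow (enum (lookup v i)) k) ≈? α
      move : ∀ {x y} → x R.+ y ≈ α → y ≈ α R.- x
      move {x} {y} e = R.trans (R.sym (xyx⁻¹≈y x y)) (R.+-congʳ e)
      moveBack : ∀ {x y} → y ≈ α R.- x → x R.+ y ≈ α
      moveBack {x} e = R.trans (R.+-congˡ e) (R.trans (R.sym (R.+-assoc x α (R.- x))) (xyx⁻¹≈y x α))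

open RationalSums

-- Finite fields

module RingPowers {c ℓ} (R : CommutativeRing c ℓ) where
  open CommutativeRing R
  open FieldOps R
  open import Algebra.Properties.CommutativeSemiring.Exp commutativeSemiring
  open import Relation.Binary.Reasoning.Setoid setoid

  pow≡^ : ∀ x n → pow x n ≡ x ^ n
  pow≡^ x zero    = ≡.refl
  pow≡^ x (suc n) = ≡.cong (x *_) (pow≡^ x n)

  pow-cong : ∀ n {x y} → x ≈ y → pow x n ≈ pow y n
  pow-cong zero    _   = refl
  pow-cong (suc n) x≈y = *-cong x≈y (pow-cong n x≈y)

  pow-+ : ∀ x m n → pow x (m ℕ.+ n) ≈ pow x m * pow x n
  pow-+ x m n rewrite pow≡^ x (m ℕ.+ n) | pow≡^ x m | pow≡^ x n = ^-homo-* x m n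

  pow-* : ∀ x m n → pow x (m ℕ.* n) ≈ pow (pow x m) n
  pow-* x m n rewrite pow≡^ x (m ℕ.* n) | pow≡^ x m | pow≡^ (x ^ m) n = sym (^-assocʳ x m n)

  pow-comm : ∀ x m n → pow (pow x m) n ≈ pow (pow x n) m
  pow-comm x m n = trans (sym (pow-* x m n)) (trans (reflexive (≡.cong (pow x) (ℕ.*-comm m n))) (pow-* x n m))

  pow-distrib : ∀ x y n → pow (x * y) n ≈ pow x n * pow y n
  pow-distrib x y n rewrite pow≡^ (x * y) n | pow≡^ x n | pow≡^ y n = ^-distrib-* x y n

  pow-one : ∀ n → pow 1# n ≈ 1#
  pow-one zero    = refl
  pow-one (suc n) = trans (*-identityˡ _) (pow-one n)

  pow-zero : ∀ n → .{{NonZero n}} → pow 0# n ≈ 0#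
  pow-zero (suc n) = zeroˡ _

  pow-multiple : ∀ {x m} → pow x m ≈ 1# → ∀ n → pow x (n ℕ.* m) ≈ 1#
  pow-multiple {x} {m} xᵐ≈1 n = begin
    pow x (n ℕ.* m)    ≡⟨ ≡.cong (pow x) (ℕ.*-comm n m) ⟩
    pow x (m ℕ.* n)    ≈⟨ pow-* x m n ⟩
    pow (pow x m) n    ≈⟨ pow-cong n xᵐ≈1 ⟩
    pow 1# n           ≈⟨ pow-one n ⟩
    1#                 ∎

  pow-% : ∀ {x} m .{{_ : NonZero m}} → pow x m ≈ 1# → ∀ j → pow x (j % m) ≈ pow x j
  pow-% {x} m xᵐ≈1 j = begin
    pow x (j % m)                               ≈⟨ *-identityʳ _ ⟨
    pow x (j % m) * 1#                          ≈⟨ *-congˡ (pow-multiple xᵐ≈1 (j / m)) ⟨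
    pow x (j % m) * pow x (j / m ℕ.* m)         ≈⟨ pow-+ x (j % m) _ ⟨
    pow x (j % m ℕ.+ j / m ℕ.* m)               ≡⟨ ≡.cong (pow x) (m≡m%n+[m/n]*n j m) ⟨
    pow x j                                     ∎

  sumF-cong : ∀ n {f g : Fin n → Carrier} → (∀ i → f i ≈ g i) → sumF n f ≈ sumF n g
  sumF-cong zero    f≈g = refl
  sumF-cong (suc n) f≈g = +-cong (f≈g Fin.zero) (sumF-cong n (f≈g ∘ Fin.suc))

  sumF-zero : ∀ n → sumF n (λ _ → 0#) ≈ 0#
  sumF-zero zero    = refl
  sumF-zero (suc n) = trans (+-identityˡ _) (sumF-zero n)

-- Cancellation and roots of polynomials over a field

module FieldProperties {c ℓ} (R : CommutativeRing c ℓ) (dec : IsFieldDec R) where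
  open CommutativeRing R
  open IsFieldDec dec
  open FieldOps R
  open RingPowers R
  open import Algebra.Properties.AbelianGroup +-abelianGroup using (x∙y⁻¹≈ε⇒x≈y)
  open import Relation.Binary.Reasoning.Setoid setoid

  *-cancelˡ : ∀ {x y z} → ¬ x ≈ 0# → x * y ≈ x * z → y ≈ z
  *-cancelˡ {x} {y} {z} x≉0 xy≈xz with x′ , xx′≈1 ← inverse x x≉0 = begin
    y               ≈⟨ expand y ⟩
    x′ * (x * y)    ≈⟨ *-congˡ xy≈xz ⟩
    x′ * (x * z)    ≈⟨ expand z ⟨
    z               ∎
    where
    expand : ∀ w → w ≈ x′ * (x * w)
    expand w = begin
      w               ≈⟨ *-identityˡ w ⟨
      1# * w          ≈⟨ *-congʳ xx′≈1 ⟨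
      (x * x′) * w    ≈⟨ *-congʳ (*-comm x x′) ⟩
      (x′ * x) * w    ≈⟨ *-assoc x′ x w ⟩
      x′ * (x * w)    ∎

  x*y≈0⇒y≈0 : ∀ {x y} → ¬ x ≈ 0# → x * y ≈ 0# → y ≈ 0#
  x*y≈0⇒y≈0 {x} x≉0 xy≈0 = *-cancelˡ x≉0 (trans xy≈0 (sym (zeroʳ x)))

  pow≈0⇒≈0 : ∀ {x} n → pow x n ≈ 0# → x ≈ 0#
  pow≈0⇒≈0 zero 1≈0 = contradiction 1≈0 1≉0
  pow≈0⇒≈0 {x} (suc n) eq with x ≈? 0#
  ... | yes x≈0 = x≈0
  ... | no  x≉0 = pow≈0⇒≈0 n (x*y≈0⇒y≈0 x≉0 eq)

  pow-cancel : ∀ {x} → ¬ x ≈ 0# → ∀ {i j} → i ℕ.≤ j → pow x i ≈ pow x j → pow x (j ∸ i) ≈ 1#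
  pow-cancel {x} x≉0 {i} {j} i≤j eq = *-cancelˡ (x≉0 ∘ pow≈0⇒≈0 i) (begin
    pow x i * pow x (j ∸ i)    ≈⟨ pow-+ x i (j ∸ i) ⟨
    pow x (i ℕ.+ (j ∸ i))      ≡⟨ ≡.cong (pow x) (ℕ.m+[n∸m]≡n i≤j) ⟩
    pow x j                    ≈⟨ eq ⟨
    pow x i                    ≈⟨ *-identityʳ _ ⟨
    pow x i * 1#               ∎)

  eval : ∀ n → (Fin n → Carrier) → Carrier → Carrier
  eval n f x = sumF n (λ i → f i * pow x (toℕ i))

  horner : ∀ n (f : Fin (suc n) → Carrier) x → eval (suc n) f x ≈ f Fin.zero + x * eval n (f ∘ Fin.suc) x
  horner n f x = +-cong (*-identityʳ _) (shift n (f ∘ Fin.suc) toℕ)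
    where
    shift : ∀ m (g : Fin m → Carrier) (e : Fin m → ℕ) →
      sumF m (λ i → g i * (x * pow x (e i))) ≈ x * sumF m (λ i → g i * pow x (e i))
    shift zero    g e = sym (zeroʳ x)
    shift (suc m) g e = begin
      g Fin.zero * (x * pow x (e Fin.zero)) + sumF m (λ i → g (Fin.suc i) * (x * pow x (e (Fin.suc i))))
        ≈⟨ +-cong (x∙yz≈y∙xz (g Fin.zero) x (pow x (e Fin.zero))) (shift m (g ∘ Fin.suc) (e ∘ Fin.suc)) ⟩
      x * (g Fin.zero * pow x (e Fin.zero)) + x * sumF m (λ i → g (Fin.suc i) * pow x (e (Fin.suc i)))
        ≈⟨ distribˡ x _ _ ⟨
      _ ∎
      where open import Algebra.Properties.CommutativeSemigroup *-commutativeSemigroup using (x∙yz≈y∙xz)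

  -- Synthetic division by X - r: the coefficient at i is the value at `r` of the polynomial left
  -- after the coefficients of `f` up to index i are dropped.
  quotient : ∀ {n} → (Fin (suc n) → Carrier) → Carrier → Fin n → Carrier
  quotient {suc n} f r Fin.zero    = eval (suc n) (f ∘ Fin.suc) r
  quotient {suc n} f r (Fin.suc i) = quotient (f ∘ Fin.suc) r i

  -- Write f = f₀ + X g. Dividing g leaves the remainder g(r), which becomes the lowest coefficient
  -- of the quotient of f.
  division : ∀ n (f : Fin (suc n) → Carrier) r x →
    eval (suc n) f x ≈ eval (suc n) f r + (x - r) * eval n (quotient f r) x
  division zero f r x = begin
    f Fin.zero * 1# + 0#                   ≈⟨ +-identityʳ _ ⟨
    (f Fin.zero * 1# + 0#) + 0#            ≈⟨ +-congˡ (zeroʳ (x - r)) ⟨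
    (f Fin.zero * 1# + 0#) + (x - r) * 0#  ∎
  division (suc n) f r x = begin
    eval (suc (suc n)) f x
      ≈⟨ horner (suc n) f x ⟩
    f₀ + x * eval (suc n) g x
      ≈⟨ +-congˡ (*-congˡ (division n g r x)) ⟩
    f₀ + x * (gr + d * h)
      ≈⟨ +-congˡ (distribˡ x gr (d * h)) ⟩
    f₀ + (x * gr + x * (d * h))
      ≈⟨ +-congˡ (+-congʳ (*-congʳ x≈d+r)) ⟩
    f₀ + ((d + r) * gr + x * (d * h))
      ≈⟨ solve 6 (λ f₀ x d r gr h → f₀ :+ ((d :+ r) :* gr :+ x :* (d :* h)) := (f₀ :+ r :* gr) :+ d :* (gr :+ x :* h))
           refl f₀ x d r gr h ⟩
    (f₀ + r * gr) + (x - r) * (gr + x * h)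
      ≈⟨ +-cong (horner (suc n) f r) (*-congˡ (horner n (quotient f r) x)) ⟨
    eval (suc (suc n)) f r + (x - r) * eval (suc n) (quotient f r) x ∎
    where
    open import Algebra.Solver.Ring.NaturalCoefficients.Default commutativeSemiring using (solve; _:+_; _:*_; _:=_)
    f₀ = f Fin.zero
    g = f ∘ Fin.suc
    gr = eval (suc n) g r
    h = eval n (quotient g r) x
    d = x - r
    x≈d+r : x ≈ d + r
    x≈d+r = sym (trans (+-assoc x (- r) r) (trans (+-congˡ (-‿inverseˡ r)) (+-identityʳ x)))

  -- The lowest coefficient of the quotient is the value at `r` of the tail `f ∘ Fin.suc`. Its
  -- vanishing therefore forces `f Fin.zero` to be the value of f, and also makes `r` a root of the
  -- tail, so that the induction continues.
  quotient≈0⇒≈0 : ∀ n (f : Fin (suc n) → Carrier) r → eval (suc n) f r ≈ 0# →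
    (∀ i → quotient f r i ≈ 0#) → ∀ i → f i ≈ 0#
  quotient≈0⇒≈0 n f r fr≈0 q≈0 Fin.zero = begin
    f Fin.zero            ≈⟨ +-identityʳ _ ⟨
    f Fin.zero + 0#       ≈⟨ +-congˡ (tail n f q≈0) ⟨
    f Fin.zero + r * eval n (f ∘ Fin.suc) r  ≈⟨ horner n f r ⟨
    eval (suc n) f r      ≈⟨ fr≈0 ⟩
    0#                    ∎
    where
    tail : ∀ n (f : Fin (suc n) → Carrier) → (∀ i → quotient f r i ≈ 0#) → r * eval n (f ∘ Fin.suc) r ≈ 0#
    tail zero    f _   = zeroʳ r
    tail (suc n) f q≈0 = trans (*-congˡ (q≈0 Fin.zero)) (zeroʳ r)
  quotient≈0⇒≈0 (suc n) f r fr≈0 q≈0 (Fin.suc i) =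
    quotient≈0⇒≈0 n (f ∘ Fin.suc) r (q≈0 Fin.zero) (q≈0 ∘ Fin.suc) i

  -- Divide by X - r₀ for the first root r₀. The other roots differ from r₀, so they remain roots of
  -- the quotient, which has one coefficient fewer.
  distinctRoots⇒≈0 : ∀ n (f r : Fin n → Carrier) → (∀ i j → r i ≈ r j → i ≡ j) →
    (∀ i → eval n f (r i) ≈ 0#) → ∀ i → f i ≈ 0#
  distinctRoots⇒≈0 (suc n) f r r-inj roots =
    quotient≈0⇒≈0 n f r₀ (roots Fin.zero)
      (distinctRoots⇒≈0 n (quotient f r₀) (r ∘ Fin.suc) (λ i j → Fin.suc-injective ∘ r-inj _ _) roots′)
    where
    r₀ = r Fin.zero
    roots′ : ∀ i → eval n (quotient f r₀) (r (Fin.suc i)) ≈ 0#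
    roots′ i = x*y≈0⇒y≈0 {x = r (Fin.suc i) - r₀}
      (λ d≈0 → contradiction (r-inj _ _ (x∙y⁻¹≈ε⇒x≈y _ _ d≈0)) λ ())
      (begin
        (r (Fin.suc i) - r₀) * eval n (quotient f r₀) (r (Fin.suc i))    ≈⟨ +-identityˡ _ ⟨
        0# + (r (Fin.suc i) - r₀) * eval n (quotient f r₀) (r (Fin.suc i))    ≈⟨ +-congʳ (roots Fin.zero) ⟨
        eval (suc n) f r₀ + (r (Fin.suc i) - r₀) * eval n (quotient f r₀) (r (Fin.suc i))
                                                                        ≈⟨ division n f r₀ (r (Fin.suc i)) ⟨
        eval (suc n) f (r (Fin.suc i))                                   ≈⟨ roots (Fin.suc i) ⟩
        0# ∎)

-- Additivity of the Frobenius map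

module FreshmansDream {c ℓ} (R : CommutativeRing c ℓ) where
  open CommutativeRing R
  open FieldOps R
  open RingPowers R
  open import Algebra.Properties.Semiring.Mult semiring using (×-assoc-*; ×-congˡ; ×-congʳ; ×-assocˡ; ×-homo-1)
    renaming (_×_ to _·_)
  open import Algebra.Properties.Semiring.Sum semiring using (sum; sum-cong-≋; sum-init-last; sum-replicate-zero)
  open import Algebra.Properties.CommutativeSemiring.Binomial commutativeSemiring using (theorem; binomial; binomialTerm)
  open import Relation.Binary.Reasoning.Setoid setoid


  CharacteristicDivides : ℕ → Set ℓ
  CharacteristicDivides n = n · 1# ≈ 0#

  multiple·≈0 : ∀ {p} → CharacteristicDivides p → ∀ {m} → p ∣ m → ∀ x → m · x ≈ 0#
  multiple·≈0 {p} p·1≈0 {m} (divides d m≡d*p) x = begin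
    m · x                  ≈⟨ ×-congˡ m≡d*p ⟩
    (d ℕ.* p) · x          ≈⟨ ×-congˡ (ℕ.*-comm d p) ⟩
    (p ℕ.* d) · x          ≈⟨ ×-assocˡ x p d ⟨
    p · (d · x)            ≈⟨ ×-congʳ p (*-identityˡ _) ⟨
    p · (1# * (d · x))     ≈⟨ ×-assoc-* p 1# _ ⟨
    (p · 1#) * (d · x)     ≈⟨ *-congʳ p·1≈0 ⟩
    0# * (d · x)           ≈⟨ zeroˡ _ ⟩
    0#                     ∎

  -- In the binomial theorem every term but the first and the last has a coefficient divisible by
  -- `p`, hence vanishes.
  pow-p-+ : ∀ {p} → Prime p → CharacteristicDivides p → ∀ x y → pow (x + y) p ≈ pow x p + pow y p
  pow-p-+ {zero}   pr _     x y = contradiction pr ¬prime[0]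
  pow-p-+ {suc p′} pr p·1≈0 x y = begin
    pow (x + y) P                                   ≡⟨ pow≡^ (x + y) P ⟩
    (x + y) ^ P                                     ≈⟨ theorem P x y ⟩
    t Fin.zero + sum {P} (t ∘ Fin.suc)              ≈⟨ +-congˡ (sum-init-last (t ∘ Fin.suc)) ⟩
    t Fin.zero + (sum {p′} (t ∘ Fin.suc ∘ inject₁) + t (Fin.suc (fromℕ p′)))
      ≈⟨ +-cong first (+-cong middle final) ⟩
    pow y P + (0# + pow x P)                        ≈⟨ +-congˡ (+-identityˡ _) ⟩
    pow y P + pow x P                               ≈⟨ +-comm _ _ ⟩
    pow x P + pow y P                               ∎
    where
    open import Algebra.Properties.Semiring.Exp semiring using (_^_)
    P = suc p′
    t : Fin (suc P) → Carrier
    t = binomialTerm x y P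
    first : t Fin.zero ≈ pow y P
    first = trans (×-homo-1 _) (trans (*-identityˡ _) (reflexive (≡.sym (pow≡^ y P))))
    middle : sum {p′} (t ∘ Fin.suc ∘ inject₁) ≈ 0#
    middle = trans (sum-cong-≋ {p′} (λ i → multiple·≈0 p·1≈0
        (prime∣C pr (ℕ.s≤s ℕ.z≤n) (ℕ.s≤s (≡.subst (ℕ._< p′) (≡.sym (toℕ-inject₁ i)) (toℕ<n i)))) _))
      (sum-replicate-zero p′)
    final : t (Fin.suc (fromℕ p′)) ≈ pow x P
    final = begin
      t (Fin.suc (fromℕ p′))                      ≡⟨ ≡.cong (λ e → (P C suc e) · (x ^ suc e * y ^ (p′ ∸ e))) (toℕ-fromℕ p′) ⟩
      (P C P) · (x ^ P * y ^ (p′ ∸ p′))           ≈⟨ ×-congˡ (nCn≡1 P) ⟩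
      1 · (x ^ P * y ^ (p′ ∸ p′))                 ≈⟨ ×-homo-1 _ ⟩
      x ^ P * y ^ (p′ ∸ p′)                       ≡⟨ ≡.cong (λ e → x ^ P * y ^ e) (ℕ.n∸n≡0 p′) ⟩
      x ^ P * 1#                                  ≈⟨ *-identityʳ _ ⟩
      x ^ P                                       ≡⟨ pow≡^ x P ⟨
      pow x P                                     ∎

  pow-+-distrib : ∀ {p} → Prime p → CharacteristicDivides p → ∀ n x y → pow (x + y) (p ℕ.^ n) ≈ pow x (p ℕ.^ n) + pow y (p ℕ.^ n)
  pow-+-distrib _ _ zero    x y = trans (*-identityʳ _) (+-cong (sym (*-identityʳ x)) (sym (*-identityʳ y)))
  pow-+-distrib {p} pr p·1≈0 (suc n) x y = begin
    pow (x + y) (p ℕ.* p ℕ.^ n)                     ≈⟨ pow-* (x + y) p _ ⟩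
    pow (pow (x + y) p) (p ℕ.^ n)                   ≈⟨ pow-cong (p ℕ.^ n) (pow-p-+ pr p·1≈0 x y) ⟩
    pow (pow x p + pow y p) (p ℕ.^ n)               ≈⟨ pow-+-distrib pr p·1≈0 n (pow x p) (pow y p) ⟩
    pow (pow x p) (p ℕ.^ n) + pow (pow y p) (p ℕ.^ n) ≈⟨ +-cong (pow-* x p _) (pow-* y p _) ⟨
    pow x (p ℕ.* p ℕ.^ n) + pow y (p ℕ.* p ℕ.^ n)   ∎

-- Characteristic and primitive element of a finite field

module FiniteField {c ℓ} (R : CommutativeRing c ℓ) (dec : IsFieldDec R) {q} (fin : FiniteOfOrder R q) where
  open CommutativeRing R
  open IsFieldDec dec
  open FiniteOfOrder fin
  open FieldOps R
  open RingPowers R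
  open FieldProperties R dec
  open FreshmansDream R
  open import Algebra.Properties.Semiring.Mult semiring using (×-congˡ; ×1-homo-*) renaming (_×_ to _·_)
  open import Algebra.Properties.Semiring.Sum semiring using (sum; sum-cong-≋; ∑-distrib-+; sum-permute; sum-replicate)
  open import Algebra.Properties.AbelianGroup +-abelianGroup using (∙-cancelˡ)
  open import Relation.Binary.Reasoning.Setoid setoid

  index : Carrier → Fin q
  index x = proj₁ (enum-surj x)

  enum-index : ∀ x → enum (index x) ≈ x
  enum-index x = proj₂ (enum-surj x)

  index-injective : ∀ {x y} → index x ≡ index y → x ≈ y
  index-injective {x} {y} eq = trans (sym (enum-index x)) (trans (reflexive (≡.cong enum eq)) (enum-index y))

  surjective⇒≤ : ∀ {m} (g : Fin m → Carrier) → (∀ x → ∃ λ i → g i ≈ x) → q ℕ.≤ m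
  surjective⇒≤ g g-surj = injective⇒≤ {f = proj₁ ∘ g-surj ∘ enum} λ {i} {j} eq →
    enum-inj i j (trans (sym (proj₂ (g-surj (enum i)))) (trans (reflexive (≡.cong g eq)) (proj₂ (g-surj (enum j)))))

  injective∧≤⇒surjective : ∀ {m} → q ℕ.≤ m → (g : Fin m → Carrier) → (∀ i j → g i ≈ g j → i ≡ j) →
    ∀ x → ∃ λ i → g i ≈ x
  injective∧≤⇒surjective q≤m g g-inj x
    with i , eq ← injective⇒surjective q≤m (index ∘ g) (λ {i} {j} e → g-inj i j (index-injective e)) (index x)
    = i , index-injective eq

  -- The translation by `1#` permutes the field, so the sum of all elements is unchanged when
  -- `q · 1#` is added to it.
  order·1≈0 : CharacteristicDivides q
  order·1≈0 = ∙-cancelˡ (sum enum) (q · 1#) 0# (begin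
    sum enum + q · 1#                          ≈⟨ +-congˡ (sum-replicate q) ⟨
    sum enum + sum {q} (λ _ → 1#)              ≈⟨ ∑-distrib-+ enum (λ _ → 1#) ⟨
    sum (λ i → enum i + 1#)                    ≈⟨ sum-cong-≋ (λ i → enum-index (enum i + 1#)) ⟨
    sum (λ i → enum (index (enum i + 1#)))     ≈⟨ sum-permute enum (mk↔ₛ′ (λ i → index (enum i + 1#)) (λ i → index (enum i - 1#)) invˡ invʳ) ⟨
    sum enum                                   ≈⟨ +-identityʳ _ ⟨
    sum enum + 0#                              ∎)
    where
    cancel : ∀ {x y z} → y + z ≈ 0# → (x + y) + z ≈ x
    cancel {x} {y} {z} y+z≈0 = trans (+-assoc x y z) (trans (+-congˡ y+z≈0) (+-identityʳ x))
    invˡ : ∀ i → index (enum (index (enum i - 1#)) + 1#) ≡ i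
    invˡ i = enum-inj _ _ (trans (enum-index _) (trans (+-congʳ (enum-index _)) (cancel (-‿inverseˡ 1#))))
    invʳ : ∀ i → index (enum (index (enum i + 1#)) - 1#) ≡ i
    invʳ i = enum-inj _ _ (trans (enum-index _) (trans (+-congʳ (enum-index _)) (cancel (-‿inverseʳ 1#))))

  pow-· : ∀ m n → (m ℕ.^ n) · 1# ≈ pow (m · 1#) n
  pow-· m zero    = +-identityʳ 1#
  pow-· m (suc n) = trans (×1-homo-* m (m ℕ.^ n)) (*-congˡ (pow-· m n))

  -- The element `q · 1#` is the n-th power of `p · 1#`, and a field has no nonzero nilpotents.
  characteristic : ∀ p n → q ≡ p ℕ.^ n → CharacteristicDivides p
  characteristic p n q≡pⁿ = pow≈0⇒≈0 n (trans (sym (pow-· p n)) (trans (×-congˡ (≡.sym q≡pⁿ)) order·1≈0))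

  module PrimitiveElement {ω} (generates : IsPrimitiveElement ω) {N} (q≡1+N : q ≡ suc N) (2≤N : 2 ℕ.≤ N) where

    private instance
      N≢0 : NonZero N
      N≢0 = ℕ.>-nonZero (ℕ.≤-trans (ℕ.n≤1+n 1) 2≤N)

    q≰ : ∀ {m} → m ℕ.≤ N → ¬ q ℕ.≤ m
    q≰ m≤N q≤m = ℕ.<⇒≱ (ℕ.s≤s m≤N) (≡.subst (ℕ._≤ _) q≡1+N q≤m)

    -- Used with several lengths: if ω ^ m = 1 with m > 0 the list covers the field, which bounds m
    -- from below; at length `N` it is a bijection with the field.
    zeroAndPowers : ∀ m → Fin (suc m) → Carrier
    zeroAndPowers m Fin.zero    = 0#
    zeroAndPowers m (Fin.suc l) = pow ω (toℕ l)

    -- `IsPrimitiveElement` does not exclude ω = 0 by itself: over a field of two elements 0 would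
    -- qualify, its powers being 1 and 0. The bound `2≤N` rules this out by leaving more than two
    -- elements to cover.
    pow-primitive≉0 : ∀ i → ¬ pow ω i ≈ 0#
    pow-primitive≉0 i ωⁱ≈0 = q≰ 2≤N (surjective⇒≤ (zeroAndPowers 1) surj)
      where
      ω≈0 : ω ≈ 0#
      ω≈0 = pow≈0⇒≈0 i ωⁱ≈0
      surj : ∀ x → ∃ λ i → zeroAndPowers 1 i ≈ x
      surj x with x ≈? 0#
      ... | yes x≈0 = Fin.zero , sym x≈0
      ... | no  x≉0 with generates x x≉0
      ... | zero  , 1≈x = Fin.suc Fin.zero , 1≈x
      ... | suc j , e   = contradiction (trans (sym e) (trans (*-congʳ ω≈0) (zeroˡ _))) x≉0

    primitive≉0 : ¬ ω ≈ 0#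
    primitive≉0 ω≈0 = pow-primitive≉0 1 (trans (*-congʳ ω≈0) (zeroˡ _))

    zeroAndPowers-surjective : ∀ m .{{_ : NonZero m}} → pow ω m ≈ 1# → ∀ x → ∃ λ i → zeroAndPowers m i ≈ x
    zeroAndPowers-surjective m ωᵐ≈1 x with x ≈? 0#
    ... | yes x≈0 = Fin.zero , sym x≈0
    ... | no  x≉0 with j , e ← generates x x≉0 =
      Fin.suc (fromℕ< (m%n<n j m)) ,
      trans (reflexive (≡.cong (pow ω) (toℕ-fromℕ< (m%n<n j m)))) (trans (pow-% m ωᵐ≈1 j) e)

    period≥N : ∀ m → 0 ℕ.< m → pow ω m ≈ 1# → N ℕ.≤ m
    period≥N m 0<m ωᵐ≈1 = ℕ.s≤s⁻¹ (≡.subst (ℕ._≤ suc m) q≡1+N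
      (surjective⇒≤ (zeroAndPowers m) (zeroAndPowers-surjective m {{ℕ.>-nonZero 0<m}} ωᵐ≈1)))

    -- Among 0 and the first q powers of ω two entries coincide, and 0 is not involved. The
    -- exponents differ by some d with 0 < d ≤ N and ω ^ d = 1, while `period≥N` gives the opposite
    -- bound.
    pow-order : pow ω N ≈ 1#
    pow-order with pigeonhole (ℕ.n<1+n q) (index ∘ zeroAndPowers q)
    ... | Fin.zero  , Fin.suc j , _   , eq = contradiction (sym (index-injective eq)) (pow-primitive≉0 (toℕ j))
    ... | Fin.suc i , Fin.suc j , i<j , eq = ≡.subst (λ m → pow ω m ≈ 1#) d≡N ωᵈ≈1
      where
      d = toℕ j ∸ toℕ i
      ωᵈ≈1 : pow ω d ≈ 1#
      ωᵈ≈1 = pow-cancel primitive≉0 (ℕ.<⇒≤ (ℕ.s≤s⁻¹ i<j)) (index-injective eq)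
      d≤N : d ℕ.≤ N
      d≤N = ℕ.≤-trans (ℕ.m∸n≤m (toℕ j) (toℕ i)) (ℕ.s≤s⁻¹ (≡.subst (toℕ j ℕ.<_) q≡1+N (toℕ<n j)))
      d≡N : d ≡ N
      d≡N = ℕ.≤-antisym d≤N (period≥N d (ℕ.m<n⇒0<n∸m (ℕ.s≤s⁻¹ i<j)) ωᵈ≈1)

    order∣ : ∀ m → pow ω m ≈ 1# → N ∣ m
    order∣ m ωᵐ≈1 with m % N in eq
    ... | zero  = m%n≡0⇒n∣m m N eq
    ... | suc r = contradiction
      (period≥N (m % N) (≡.subst (0 ℕ.<_) (≡.sym eq) (ℕ.s≤s ℕ.z≤n)) (trans (pow-% N pow-order m) ωᵐ≈1))
      (ℕ.<⇒≱ (m%n<n m N))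

    pow-injective-≤ : ∀ {i j} → i ℕ.≤ j → j ℕ.< N → pow ω i ≈ pow ω j → i ≡ j
    pow-injective-≤ {i} {j} i≤j j<N eq with j ∸ i in d
                                          | order∣ (j ∸ i) (pow-cancel primitive≉0 i≤j eq)
    ... | zero  | _ = ℕ.≤-antisym i≤j (ℕ.m∸n≡0⇒m≤n d)
    ... | suc e | N∣ = contradiction (ℕ.≤-trans (∣⇒≤ N∣) (ℕ.≤-trans (ℕ.≤-reflexive (≡.sym d)) (ℕ.m∸n≤m j i))) (ℕ.<⇒≱ j<N)

    pow-injective : ∀ {i j} → i ℕ.< N → j ℕ.< N → pow ω i ≈ pow ω j → i ≡ j
    pow-injective {i} {j} i<N j<N eq with ℕ.≤-total i j
    ... | inj₁ i≤j = pow-injective-≤ i≤j j<N eq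
    ... | inj₂ j≤i = ≡.sym (pow-injective-≤ j≤i i<N (sym eq))

    zeroAndPowers-injective : ∀ i j → zeroAndPowers N i ≈ zeroAndPowers N j → i ≡ j
    zeroAndPowers-injective Fin.zero    Fin.zero    _ = ≡.refl
    zeroAndPowers-injective Fin.zero    (Fin.suc j) e = contradiction (sym e) (pow-primitive≉0 (toℕ j))
    zeroAndPowers-injective (Fin.suc i) Fin.zero    e = contradiction e (pow-primitive≉0 (toℕ i))
    zeroAndPowers-injective (Fin.suc i) (Fin.suc j) e = ≡.cong Fin.suc (toℕ-injective (pow-injective (toℕ<n i) (toℕ<n j) e))

-- The subfield of order Q and independence over it

module Subfield {c ℓ} (R : CommutativeRing c ℓ) (dec : IsFieldDec R) {p} (pr : Prime p)
  (char : FreshmansDream.CharacteristicDivides R p) (a : ℕ) where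
  open CommutativeRing R
  open FieldOps R
  open RingPowers R
  open FieldProperties R dec
  open FreshmansDream R
  open import Algebra.Properties.AbelianGroup +-abelianGroup using (x∙y⁻¹≈ε⇒x≈y; inverseʳ-unique)
  open import Relation.Binary.Reasoning.Setoid setoid

  private
    Q = p ℕ.^ a
    pow-pⁿ-zero : ∀ n → pow 0# (p ℕ.^ n) ≈ 0#
    pow-pⁿ-zero n = pow-zero (p ℕ.^ n) {{ℕ.m^n≢0 p n {{prime⇒nonZero pr}}}}

  pow-pⁿ-+ : ∀ n x y → pow (x + y) (p ℕ.^ n) ≈ pow x (p ℕ.^ n) + pow y (p ℕ.^ n)
  pow-pⁿ-+ = pow-+-distrib pr char

  pow-pⁿ-neg : ∀ n x → pow (- x) (p ℕ.^ n) ≈ - pow x (p ℕ.^ n)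
  pow-pⁿ-neg n x = inverseʳ-unique _ _ (begin
    pow x (p ℕ.^ n) + pow (- x) (p ℕ.^ n)    ≈⟨ pow-pⁿ-+ n x (- x) ⟨
    pow (x + - x) (p ℕ.^ n)                  ≈⟨ pow-cong (p ℕ.^ n) (-‿inverseʳ x) ⟩
    pow 0# (p ℕ.^ n)                         ≈⟨ pow-pⁿ-zero n ⟩
    0#                                       ∎)

  -- The map is additive, so only its kernel matters, and a power that vanishes has a vanishing
  -- base.
  pow-pⁿ-injective : ∀ n {x y} → pow x (p ℕ.^ n) ≈ pow y (p ℕ.^ n) → x ≈ y
  pow-pⁿ-injective n {x} {y} eq = x∙y⁻¹≈ε⇒x≈y x y (pow≈0⇒≈0 (p ℕ.^ n) (begin
    pow (x - y) (p ℕ.^ n)                    ≈⟨ pow-pⁿ-+ n x (- y) ⟩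
    pow x (p ℕ.^ n) + pow (- y) (p ℕ.^ n)    ≈⟨ +-cong eq (pow-pⁿ-neg n y) ⟩
    pow y (p ℕ.^ n) - pow y (p ℕ.^ n)        ≈⟨ -‿inverseʳ _ ⟩
    0#                                       ∎))

  pow-pⁿ-sumF : ∀ n m (f : Fin m → Carrier) → pow (sumF m f) (p ℕ.^ n) ≈ sumF m (λ i → pow (f i) (p ℕ.^ n))
  pow-pⁿ-sumF n zero    f = pow-pⁿ-zero n
  pow-pⁿ-sumF n (suc m) f = trans (pow-pⁿ-+ n _ _) (+-congˡ (pow-pⁿ-sumF n m (f ∘ Fin.suc)))

  InSubfield-zero : InSubfield Q 0#
  InSubfield-zero = pow-pⁿ-zero a

  InSubfield-minus : ∀ {x y} → InSubfield Q x → InSubfield Q y → InSubfield Q (x - y)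
  InSubfield-minus {x} {y} x∈ y∈ = trans (pow-pⁿ-+ a x (- y)) (+-cong x∈ (trans (pow-pⁿ-neg a y) (-‿cong y∈)))

  InSubfield-pow : ∀ {x} → InSubfield Q x → ∀ j → pow x (p ℕ.^ (a ℕ.* j)) ≈ x
  InSubfield-pow {x} x∈ j = trans (reflexive (≡.cong (pow x) (≡.sym (ℕ.^-*-assoc p a j)))) (iterate j)
    where
    iterate : ∀ j → pow x (Q ℕ.^ j) ≈ x
    iterate zero    = *-identityʳ x
    iterate (suc j) = trans (pow-* x Q (Q ℕ.^ j)) (trans (pow-cong (Q ℕ.^ j) x∈) (iterate j))

  -- A polynomial of degree < b over the subfield that kills ζ also kills its b distinct
  -- conjugates under x ↦ x ^ Q.
  independent : ∀ b ζ → (∀ d → 0 ℕ.< d → d ℕ.< b → ¬ pow ζ (p ℕ.^ (a ℕ.* d)) ≈ ζ) →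
    ∀ cs → (∀ i → InSubfield Q (cs i)) → eval b cs ζ ≈ 0# → ∀ i → cs i ≈ 0#
  independent b ζ noPeriod cs cs∈ csζ≈0 = distinctRoots⇒≈0 b cs conj conj-injective roots
    where
    conj : Fin b → Carrier
    conj i = pow ζ (p ℕ.^ (a ℕ.* toℕ i))
    -- If the conjugates i < j agree, injectivity of the p ^ (a i)-th power map strips that exponent
    -- from both and leaves ζ fixed by the exponent p ^ (a (j - i)).
    conj-< : ∀ {i j : Fin b} → toℕ i ℕ.< toℕ j → ¬ conj i ≈ conj j
    conj-< {i} {j} i<j eq = noPeriod d (ℕ.m<n⇒0<n∸m i<j) (ℕ.≤-<-trans (ℕ.m∸n≤m (toℕ j) (toℕ i)) (toℕ<n j))
      (pow-pⁿ-injective (a ℕ.* toℕ i) (begin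
        pow (pow ζ (p ℕ.^ (a ℕ.* d))) (p ℕ.^ (a ℕ.* toℕ i))    ≈⟨ pow-* ζ (p ℕ.^ (a ℕ.* d)) (p ℕ.^ (a ℕ.* toℕ i)) ⟨
        pow ζ (p ℕ.^ (a ℕ.* d) ℕ.* p ℕ.^ (a ℕ.* toℕ i))        ≡⟨ ≡.cong (pow ζ) (ℕ.^-distribˡ-+-* p (a ℕ.* d) (a ℕ.* toℕ i)) ⟨
        pow ζ (p ℕ.^ (a ℕ.* d ℕ.+ a ℕ.* toℕ i))
          ≡⟨ ≡.cong (λ e → pow ζ (p ℕ.^ e)) (≡.trans (≡.sym (ℕ.*-distribˡ-+ a d (toℕ i)))
               (≡.cong (a ℕ.*_) (ℕ.m∸n+n≡m (ℕ.<⇒≤ i<j)))) ⟩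
        conj j                                                 ≈⟨ eq ⟨
        pow ζ (p ℕ.^ (a ℕ.* toℕ i))                            ∎))
      where d = toℕ j ∸ toℕ i
    conj-injective : ∀ i j → conj i ≈ conj j → i ≡ j
    conj-injective i j eq with ℕ.<-cmp (toℕ i) (toℕ j)
    ... | tri< i<j _ _ = contradiction eq (conj-< i<j)
    ... | tri≈ _ i≡j _ = toℕ-injective i≡j
    ... | tri> _ _ j<i = contradiction (sym eq) (conj-< j<i)
    roots : ∀ i → eval b cs (conj i) ≈ 0#
    roots i = begin
      sumF b (λ h → cs h * pow (pow ζ e) (toℕ h))
        ≈⟨ sumF-cong b (λ h → trans (pow-distrib (cs h) (pow ζ (toℕ h)) e)
             (*-cong (InSubfield-pow (cs∈ h) (toℕ i)) (pow-comm ζ (toℕ h) e))) ⟨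
      sumF b (λ h → pow (cs h * pow ζ (toℕ h)) e)
        ≈⟨ pow-pⁿ-sumF (a ℕ.* toℕ i) b _ ⟨
      pow (eval b cs ζ) e    ≈⟨ pow-cong e csζ≈0 ⟩
      pow 0# e               ≈⟨ pow-pⁿ-zero (a ℕ.* toℕ i) ⟩
      0#                     ∎
      where e = p ℕ.^ (a ℕ.* toℕ i)

-- The k-th powers and the coordinates they change

module PowerSums {c ℓ} (p a b k m : ℕ) (pr : Prime p) (1≤a : 1 ℕ.≤ a) (1<b : 1 ℕ.< b)
  (pᵃ≡2+m : p ℕ.^ a ≡ suc (suc m))
  (order : p ℕ.^ (a ℕ.* b) ≡ suc (k ℕ.* (suc m ℕ.* b))) (1≤k : 1 ℕ.≤ k)
  (noSmallerField : ∀ h → 1 ℕ.≤ h → h ℕ.< a ℕ.* b → ¬ (suc m ℕ.* b ∣ p ℕ.^ h ∸ 1))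
  (R : CommutativeRing c ℓ) (dec : IsFieldDec R) (fin : FiniteOfOrder R (p ℕ.^ (a ℕ.* b)))
  (ω : CommutativeRing.Carrier R) (generates : FieldOps.IsPrimitiveElement R ω) where

  open CommutativeRing R
  open import Algebra.Properties.Semiring.Sum (CommutativeRing.semiring ℚ.+-*-commutativeRing)
    using (sum; sum-cong-≗; sum-permute; ∑-comm; *-distribˡ-sum)
  open IsFieldDec dec
  open FiniteOfOrder fin
  open FieldOps R
  open Counting R dec fin
  open RingPowers R
  open FieldProperties R dec
  open FiniteField R dec fin
  open MsProperties R dec fin
  open Subfield R dec pr (characteristic p (a ℕ.* b) ≡.refl) a
  open import Algebra.Properties.AbelianGroup +-abelianGroup using (x∙y⁻¹≈ε⇒x≈y; ⁻¹-∙-comm; ε⁻¹≈ε)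
  open import Algebra.Properties.CommutativeSemigroup +-commutativeSemigroup using (interchange; xy∙z≈xz∙y)
  open import Algebra.Properties.Ring ring using (-‿distribˡ-*)
  open import Relation.Binary.Reasoning.Setoid setoid

  -- `n` is the number Q - 1 of units of K, and `N` is the number of units of the whole field.
  Q q n N : ℕ
  Q = p ℕ.^ a
  q = p ℕ.^ (a ℕ.* b)
  n = suc m
  N = k ℕ.* (n ℕ.* b)

  instance
    k≢0 : NonZero k
    k≢0 = ℕ.>-nonZero 1≤k
    b≢0 : NonZero b
    b≢0 = ℕ.>-nonZero (ℕ.<-trans (ℕ.s≤s ℕ.z≤n) 1<b)
    kb≢0 : NonZero (k ℕ.* b)
    kb≢0 = ℕ.m*n≢0 k b

  2≤N : 2 ℕ.≤ N
  2≤N = ℕ.≤-trans 1<b (ℕ.≤-trans (ℕ.m≤n*m b n) (ℕ.m≤n*m (n ℕ.* b) k))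

  open PrimitiveElement generates order 2≤N

  ζ θ : Carrier
  ζ = pow ω k
  θ = pow ζ b

  ζ-order : pow ζ (n ℕ.* b) ≈ 1#
  ζ-order = trans (sym (pow-* ω k (n ℕ.* b))) pow-order

  θ-order : pow θ n ≈ 1#
  θ-order = trans (sym (pow-* ζ b n)) (trans (reflexive (≡.cong (pow ζ) (ℕ.*-comm b n))) ζ-order)

  θ≈ : ∀ t → pow θ t ≈ pow ω (k ℕ.* b ℕ.* t)
  θ≈ t = trans (pow-cong t (sym (pow-* ω k b))) (sym (pow-* ω (k ℕ.* b) t))

  n*kb≡N : n ℕ.* (k ℕ.* b) ≡ N
  n*kb≡N = ≡.trans (≡.sym (ℕ.*-assoc n k b)) (≡.trans (≡.cong (ℕ._* b) (ℕ.*-comm n k)) (ℕ.*-assoc k n b))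

  powθ∈ : ∀ l → InSubfield Q (pow θ l)
  powθ∈ l = trans (pow-comm θ l Q) (pow-cong l (trans (reflexive (≡.cong (pow θ) pᵃ≡2+m))
    (trans (*-congˡ θ-order) (*-identityʳ θ))))

  powθ≉0 : ∀ l → ¬ pow θ l ≈ 0#
  powθ≉0 l e = pow-primitive≉0 (k ℕ.* b ℕ.* l) (trans (sym (θ≈ l)) e)

  powθ-injective : ∀ {l l′ : Fin n} → pow θ (toℕ l) ≈ pow θ (toℕ l′) → l ≡ l′
  powθ-injective {l} {l′} e = toℕ-injective (ℕ.*-cancelˡ-≡ (toℕ l) (toℕ l′) (k ℕ.* b)
    (pow-injective (bound l) (bound l′) (trans (sym (θ≈ (toℕ l))) (trans e (θ≈ (toℕ l′))))))
    where
    bound : ∀ (l : Fin n) → k ℕ.* b ℕ.* toℕ l ℕ.< N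
    bound l = ≡.subst (k ℕ.* b ℕ.* toℕ l ℕ.<_) (≡.trans (ℕ.*-comm (k ℕ.* b) n) n*kb≡N) (ℕ.*-monoʳ-< (k ℕ.* b) (toℕ<n l))

  -- Write y = ω ^ j. Cancelling y in y ^ Q = y gives ω ^ (n j) = 1, so N = n (k b) divides n j.
  -- Hence k b divides j, and ω ^ (k b) is θ.
  powθ-surjective : ∀ {y} → InSubfield Q y → ¬ y ≈ 0# → ∃ λ (l : Fin n) → pow θ (toℕ l) ≈ y
  powθ-surjective {y} y∈ y≉0 with generates y y≉0
  ... | j , ωʲ≈y = fromℕ< (m%n<n t n) , (begin
      pow θ (toℕ (fromℕ< (m%n<n t n)))    ≡⟨ ≡.cong (pow θ) (toℕ-fromℕ< (m%n<n t n)) ⟩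
      pow θ (t % n)                       ≈⟨ pow-% n θ-order t ⟩
      pow θ t                             ≈⟨ θ≈ t ⟩
      pow ω (k ℕ.* b ℕ.* t)               ≡⟨ ≡.cong (pow ω) (≡.trans (ℕ.*-comm (k ℕ.* b) t) (≡.sym (_∣_.equality kb∣j))) ⟩
      pow ω j                             ≈⟨ ωʲ≈y ⟩
      y                                   ∎)
    where
    yⁿ≈1 : pow y n ≈ 1#
    yⁿ≈1 = *-cancelˡ y≉0 (trans (trans (reflexive (≡.cong (pow y) (≡.sym pᵃ≡2+m))) y∈) (sym (*-identityʳ y)))
    ω^nj≈1 : pow ω (n ℕ.* j) ≈ 1#
    ω^nj≈1 = trans (reflexive (≡.cong (pow ω) (ℕ.*-comm n j))) (trans (pow-* ω j n) (trans (pow-cong n ωʲ≈y) yⁿ≈1))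
    kb∣j : k ℕ.* b ∣ j
    kb∣j = *-cancelˡ-∣ n (≡.subst (_∣ n ℕ.* j) (≡.sym n*kb≡N) (order∣ (n ℕ.* j) ω^nj≈1))
    t = _∣_.quotient kb∣j

  -- Primitivity of the divisor enters here. If the exponent p ^ (a d) fixes ζ = ω ^ k, then N = k
  -- (n b) divides k (p ^ (a d) - 1); cancelling k makes n b divide p ^ (a d) - 1 although a d < a
  -- b.
  ζ-noPeriod : ∀ d → 0 ℕ.< d → d ℕ.< b → ¬ pow ζ (p ℕ.^ (a ℕ.* d)) ≈ ζ
  ζ-noPeriod d 0<d d<b eq = noSmallerField (a ℕ.* d) (ℕ.*-mono-≤ 1≤a 0<d) (ℕ.*-monoʳ-< a {{ℕ.>-nonZero 1≤a}} d<b)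
    (*-cancelˡ-∣ k (≡.subst (N ∣_) difference (order∣ (k ℕ.* P ∸ k ℕ.* 1)
    (pow-cancel primitive≉0 (ℕ.*-monoʳ-≤ k 1≤P) (begin
      pow ω (k ℕ.* 1)    ≡⟨ ≡.cong (pow ω) (ℕ.*-identityʳ k) ⟩
      ζ                  ≈⟨ eq ⟨
      pow ζ P            ≈⟨ pow-* ω k P ⟨
      pow ω (k ℕ.* P)    ∎)))))
    where
    P = p ℕ.^ (a ℕ.* d)
    1≤P : 1 ℕ.≤ P
    1≤P = ℕ.m^n>0 p {{prime⇒nonZero pr}} (a ℕ.* d)
    difference : k ℕ.* P ∸ k ℕ.* 1 ≡ k ℕ.* (P ∸ 1)
    difference = ≡.sym (ℕ.*-distribˡ-∸ k P 1)

  expand : (Fin b → Carrier) → Carrier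
  expand cs = sumF b (λ i → cs i * pow ω (toℕ i ℕ.* k))

  expand≈0⇒≈0 : ∀ cs → (∀ i → InSubfield Q (cs i)) → expand cs ≈ 0# → ∀ i → cs i ≈ 0#
  expand≈0⇒≈0 cs cs∈ e = independent b ζ ζ-noPeriod cs cs∈
    (trans (sumF-cong b (λ i → *-congˡ (trans (sym (pow-* ω k (toℕ i))) (reflexive (≡.cong (pow ω) (ℕ.*-comm k (toℕ i))))))) e)

  sumF-minus : ∀ n (f g : Fin n → Carrier) (e : Fin n → Carrier) →
    sumF n (λ i → (f i - g i) * e i) ≈ sumF n (λ i → f i * e i) - sumF n (λ i → g i * e i)
  sumF-minus zero    f g e = sym (-‿inverseʳ 0#)
  sumF-minus (suc n) f g e = begin
    (f₀ - g₀) * e₀ + sumF n (λ i → (f (Fin.suc i) - g (Fin.suc i)) * e (Fin.suc i))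
      ≈⟨ +-cong (trans (distribʳ e₀ f₀ (- g₀)) (+-congˡ (sym (-‿distribˡ-* g₀ e₀))))
           (sumF-minus n (f ∘ Fin.suc) (g ∘ Fin.suc) (e ∘ Fin.suc)) ⟩
    (f₀ * e₀ - g₀ * e₀) + (F - G)      ≈⟨ interchange (f₀ * e₀) (- (g₀ * e₀)) F (- G) ⟩
    (f₀ * e₀ + F) + (- (g₀ * e₀) - G)  ≈⟨ +-congˡ (⁻¹-∙-comm (g₀ * e₀) G) ⟩
    (f₀ * e₀ + F) - (g₀ * e₀ + G)      ∎
    where
    f₀ = f Fin.zero
    g₀ = g Fin.zero
    e₀ = e Fin.zero
    F = sumF n (λ i → f (Fin.suc i) * e (Fin.suc i))
    G = sumF n (λ i → g (Fin.suc i) * e (Fin.suc i))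

  coordinatesExist : ∀ α → ∃ λ cs → IsCoordVec Q k b ω α cs
  coordinatesExist α = κ ∘ finToFun e₀ , (κ∈ ∘ finToFun e₀) , sym (proj₂ preimage)
    where
    -- 0 and the powers of θ list K, and `suc n` is Q. A coefficient vector is thus coded by an
    -- element of `Fin (suc n ℕ.^ b)`, a type with as many elements as the field.
    κ : Fin (suc n) → Carrier
    κ Fin.zero    = 0#
    κ (Fin.suc l) = pow θ (toℕ l)
    κ∈ : ∀ i → InSubfield Q (κ i)
    κ∈ Fin.zero    = InSubfield-zero
    κ∈ (Fin.suc l) = powθ∈ (toℕ l)
    κ-injective : ∀ i j → κ i ≈ κ j → i ≡ j
    κ-injective Fin.zero    Fin.zero    _ = ≡.refl
    κ-injective Fin.zero    (Fin.suc j) e = contradiction (sym e) (powθ≉0 (toℕ j))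
    κ-injective (Fin.suc i) Fin.zero    e = contradiction e (powθ≉0 (toℕ i))
    κ-injective (Fin.suc i) (Fin.suc j) e = ≡.cong Fin.suc (powθ-injective e)
    g : Fin (suc n ℕ.^ b) → Carrier
    g e = expand (κ ∘ finToFun e)
    q≤ : q ℕ.≤ suc n ℕ.^ b
    q≤ = ℕ.≤-reflexive (≡.trans (≡.sym (ℕ.^-*-assoc p a b)) (≡.cong (ℕ._^ b) pᵃ≡2+m))
    g-injective : ∀ e e′ → g e ≈ g e′ → e ≡ e′
    g-injective e e′ eq = finToFun-injective e e′ (λ i → κ-injective _ _ (x∙y⁻¹≈ε⇒x≈y _ _
      (expand≈0⇒≈0 (λ i → κ (finToFun e i) - κ (finToFun e′ i))
        (λ i → InSubfield-minus (κ∈ (finToFun e i)) (κ∈ (finToFun e′ i)))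
        (trans (sumF-minus b _ _ _) (trans (+-congʳ eq) (-‿inverseʳ _))) i)))
    preimage : ∃ λ e → g e ≈ α
    preimage = injective∧≤⇒surjective q≤ g g-injective α
    e₀ = proj₁ preimage

  -- Reindex the field by 0 and the ω ^ e, and write e = n b x + b l + i in mixed radix with x < k,
  -- l < n, i < b. Since ζ ^ (n b) = 1, the k-th power ζ ^ e does not depend on x, which accounts
  -- for the factor k.
  sum-powers : ∀ (h : Carrier → ℚ) → (∀ {x y} → x ≈ y → h x ≡ h y) →
    sum (λ i → h (pow (enum i) k)) ≡
    h 0# ℚ.+ ℕ→ℚ k ℚ.* sum (λ (i : Fin b) → sum (λ (l : Fin n) → h (pow θ (toℕ l) * pow ω (toℕ i ℕ.* k))))
  sum-powers h h-cong = ≡R.begin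
    sum (λ i → h (pow (enum i) k))
      ≡R.≡⟨ sum-permute (λ i → h (pow (enum i) k)) (mk↔ₛ′ (index ∘ g) (proj₁ ∘ g-surj ∘ enum) invˡ invʳ) ⟩
    sum (λ e → h (pow (enum (index (g e))) k))
      ≡R.≡⟨ sum-cong-≗ (λ e → h-cong (pow-cong k (enum-index (g e)))) ⟩
    h (pow 0# k) ℚ.+ sum {N} (λ e → h (pow (pow ω (toℕ e)) k))
      ≡R.≡⟨ ≡.cong₂ ℚ._+_ (h-cong (pow-zero k)) (sum-combine k (n ℕ.* b) (λ e → h (pow (pow ω (toℕ e)) k))) ⟩
    h 0# ℚ.+ sum (λ (x : Fin k) → sum (λ (y : Fin (n ℕ.* b)) → h (pow (pow ω (toℕ (combine x y))) k)))
      ≡R.≡⟨ ≡.cong (h 0# ℚ.+_) (sum-cong-≗ {k} (λ x → ≡.trans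
             (sum-combine n b (λ y → h (pow (pow ω (toℕ (combine x y))) k)))
             (≡.trans (sum-cong-≗ {n} (λ l → sum-cong-≗ {b} (λ i → h-cong (exponent x l i)))) (∑-comm {n} {b} H)))) ⟩
    h 0# ℚ.+ sum {k} (λ _ → S)
      ≡R.≡⟨ ≡.cong (h 0# ℚ.+_) (sum-const k S) ⟩
    h 0# ℚ.+ ℕ→ℚ k ℚ.* S ≡R.∎
    where
    module ≡R = ≡.≡-Reasoning
    H : Fin n → Fin b → ℚ
    H l i = h (pow θ (toℕ l) * pow ω (toℕ i ℕ.* k))
    S = sum (λ i → sum (λ l → H l i))
    g = zeroAndPowers N
    g-surj = zeroAndPowers-surjective N {{ℕ.>-nonZero (ℕ.<-trans (ℕ.s≤s ℕ.z≤n) 2≤N)}} pow-order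
    invˡ : ∀ i → index (g (proj₁ (g-surj (enum i)))) ≡ i
    invˡ i = enum-inj _ _ (trans (enum-index _) (proj₂ (g-surj (enum i))))
    invʳ : ∀ e → proj₁ (g-surj (enum (index (g e)))) ≡ e
    invʳ e = zeroAndPowers-injective _ _ (trans (proj₂ (g-surj (enum (index (g e))))) (enum-index (g e)))
    exponent : ∀ x l i → pow (pow ω (toℕ (combine {k} x (combine {n} {b} l i)))) k ≈ pow θ (toℕ l) * pow ω (toℕ i ℕ.* k)
    exponent x l i = begin
      pow (pow ω (toℕ (combine x (combine l i)))) k
        ≈⟨ pow-comm ω (toℕ (combine x (combine l i))) k ⟩
      pow ζ (toℕ (combine x (combine l i)))
        ≡⟨ ≡.cong (pow ζ) (≡.trans (toℕ-combine x (combine l i)) (≡.cong (n ℕ.* b ℕ.* toℕ x ℕ.+_) (toℕ-combine l i))) ⟩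
      pow ζ (n ℕ.* b ℕ.* toℕ x ℕ.+ (b ℕ.* toℕ l ℕ.+ toℕ i))
        ≈⟨ pow-+ ζ (n ℕ.* b ℕ.* toℕ x) _ ⟩
      pow ζ (n ℕ.* b ℕ.* toℕ x) * pow ζ (b ℕ.* toℕ l ℕ.+ toℕ i)
        ≈⟨ *-cong (trans (reflexive (≡.cong (pow ζ) (ℕ.*-comm (n ℕ.* b) (toℕ x)))) (pow-multiple ζ-order (toℕ x)))
             (pow-+ ζ (b ℕ.* toℕ l) (toℕ i)) ⟩
      1# * (pow ζ (b ℕ.* toℕ l) * pow ζ (toℕ i))
        ≈⟨ *-identityˡ _ ⟩
      pow ζ (b ℕ.* toℕ l) * pow ζ (toℕ i)
        ≈⟨ *-cong (sym (pow-* ζ b (toℕ l))) (trans (reflexive (≡.cong (pow ω) (ℕ.*-comm (toℕ i) k))) (pow-* ω k (toℕ i))) ⟨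
      pow θ (toℕ l) * pow ω (toℕ i ℕ.* k) ∎

  -- The recurrence on coordinate vectors and the final count

  SubfieldElement : Set _
  SubfieldElement = Σ Carrier (InSubfield Q)

  shift : Fin n → SubfieldElement → SubfieldElement
  shift l (y , y∈) = y - pow θ (toℕ l) , InSubfield-minus y∈ (powθ∈ (toℕ l))

  weight : SubfieldElement → ℕ → ℚ
  weight (y , _) = aCoeff Q (y ≈ 0#) (y ≈? 0#)

  -- This is why `SubfieldElement` carries its membership proof: for y outside K no shift would
  -- reach 0, and the recurrence would already fail at r = 0.
  weight-suc : ∀ y r → weight y (suc r) ≡ sum (λ l → weight (shift l y) r)
  weight-suc (y , y∈) = ≡.subst
    (λ Q → ∀ r → aCoeff Q (y ≈ 0#) (y ≈? 0#) (suc r) ≡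
                 sum (λ (l : Fin n) → aCoeff Q (y - pow θ (toℕ l) ≈ 0#) ((y - pow θ (toℕ l)) ≈? 0#) r))
    (≡.sym pᵃ≡2+m)
    (aCoeff-suc m (y ≈? 0#) (λ l → (y - pow θ (toℕ l)) ≈? 0#)
      (λ y≈0 l e → powθ≉0 (toℕ l) (trans (sym (x∙y⁻¹≈ε⇒x≈y _ _ e)) y≈0))
      nonzeroCase)
    where
    -- The unique shift that reaches 0 is the discrete logarithm of y to the base θ.
    nonzeroCase : ¬ y ≈ 0# → ∃ λ (l₀ : Fin n) → (y - pow θ (toℕ l₀) ≈ 0#) × (∀ l → y - pow θ (toℕ l) ≈ 0# → l ≡ l₀)
    nonzeroCase y≉0 with l₀ , e₀ ← powθ-surjective y∈ y≉0 =
      l₀ , trans (+-congˡ (-‿cong e₀)) (-‿inverseʳ y) ,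
      λ l e → powθ-injective (trans (sym (x∙y⁻¹≈ε⇒x≈y _ _ e)) (sym e₀))

  -- An arbitrary length and arbitrary vectors `e` in place of the basis let the induction drop the
  -- first coordinate.
  expand-updateAt : ∀ m (y : Fin m → SubfieldElement) (e : Fin m → Carrier) i l →
    sumF m (λ j → proj₁ (updateAt y i (shift l) j) * e j) ≈ sumF m (λ j → proj₁ (y j) * e j) - pow θ (toℕ l) * e i
  expand-updateAt (suc m) y e Fin.zero l = begin
    (y₀ - t) * e₀ + S            ≈⟨ +-congʳ (trans (distribʳ e₀ y₀ (- t)) (+-congˡ (sym (-‿distribˡ-* t e₀)))) ⟩
    (y₀ * e₀ - t * e₀) + S       ≈⟨ xy∙z≈xz∙y _ _ _ ⟩
    (y₀ * e₀ + S) - t * e₀       ∎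
    where
    y₀ = proj₁ (y Fin.zero)
    e₀ = e Fin.zero
    t = pow θ (toℕ l)
    S = sumF m (λ j → proj₁ (y (Fin.suc j)) * e (Fin.suc j))
  expand-updateAt (suc m) y e (Fin.suc i) l =
    trans (+-congˡ (expand-updateAt m (y ∘ Fin.suc) (e ∘ Fin.suc) i l)) (sym (+-assoc _ _ _))

  E : (Fin b → SubfieldElement) → ℕ → ℚ
  E y = multinomialSum (λ i → weight (y i))

  weight-zero-true : ∀ y → proj₁ y ≈ 0# → weight y 0 ≡ 1ℚ
  weight-zero-true y y≈0 = ≡.subst (λ Q → aCoeff Q _ (proj₁ y ≈? 0#) 0 ≡ 1ℚ) (≡.sym pᵃ≡2+m)
    (aCoeff-zero-true m (proj₁ y ≈? 0#) y≈0)

  weight-zero-false : ∀ y → ¬ proj₁ y ≈ 0# → weight y 0 ≡ 0ℚ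
  weight-zero-false y y≉0 = ≡.subst (λ Q → aCoeff Q _ (proj₁ y ≈? 0#) 0 ≡ 0ℚ) (≡.sym pᵃ≡2+m)
    (aCoeff-zero-false m (proj₁ y ≈? 0#) y≉0)

  -- `E y 0` is N_0. By independence α = 0 has only zero coordinates, each contributing the factor
  -- 1; in the next lemma a single nonzero coordinate contributes the factor 0.
  E-zero-true : ∀ {α} y → α ≈ expand (proj₁ ∘ y) → α ≈ 0# → E y 0 ≡ 1ℚ
  E-zero-true y α≈ α≈0 = multinomialSum-zero-one (λ i → weight (y i)) (λ i → weight-zero-true (y i)
    (expand≈0⇒≈0 (proj₁ ∘ y) (proj₂ ∘ y) (trans (sym α≈) α≈0) i))

  E-zero-false : ∀ {α} y → α ≈ expand (proj₁ ∘ y) → ¬ α ≈ 0# → E y 0 ≡ 0ℚ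
  E-zero-false y α≈ α≉0 = multinomialSum-zero-zero (λ i → weight (y i)) (proj₁ someNonzero)
    (weight-zero-false (y (proj₁ someNonzero)) (proj₂ someNonzero))
    where
    notAll : ¬ (∀ i → proj₁ (y i) ≈ 0#)
    notAll y≈0 = α≉0 (trans α≈ (trans (sumF-cong b (λ i → trans (*-congʳ (y≈0 i)) (zeroˡ _))) (sumF-zero b)))
    someNonzero : ∃ λ i → ¬ proj₁ (y i) ≈ 0#
    someNonzero = ¬∀⟶∃¬ b (λ i → proj₁ (y i) ≈ 0#) (λ i → proj₁ (y i) ≈? 0#) notAll

  -- In the summand, r counts the nonzero variables and the ignored second index counts the zero
  -- ones, so one step of `leibniz` decides which kind the new variable is. The vector `y` is
  -- quantified after `s` because the induction hypothesis is applied to α - θ ^ l ζ ^ i with its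
  -- updated coordinates.
  Ms-leibniz : ∀ s {α} y → α ≈ expand (proj₁ ∘ y) →
    ℕ→ℚ (Ms k s α) ≡ leibniz s (λ r _ → powℚ (ℕ→ℚ k) r ℚ.* E y r)
  Ms-leibniz zero {α} y α≈ with α ≈? 0#
  ... | yes α≈0 = ≡.trans (≡.cong ℕ→ℚ (Ms-zero-true k α≈0)) (≡.cong (1ℚ ℚ.*_) (≡.sym (E-zero-true y α≈ α≈0)))
  ... | no  α≉0 = ≡.trans (≡.cong ℕ→ℚ (Ms-zero-false k α≉0)) (≡.cong (1ℚ ℚ.*_) (≡.sym (E-zero-false y α≈ α≉0)))
  Ms-leibniz (suc s) {α} y α≈ = ≡R.begin
    ℕ→ℚ (Ms k (suc s) α)
      ≡R.≡⟨ Ms-suc k s α ⟩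
    sum (λ i → h (pow (enum i) k))
      ≡R.≡⟨ sum-powers h (λ x≈y → ≡.cong ℕ→ℚ (Ms-cong k s (+-congˡ (-‿cong x≈y)))) ⟩
    h 0# ℚ.+ κ ℚ.* sum (λ (i : Fin b) → sum (λ (l : Fin n) → h (pow θ (toℕ l) * pow ω (toℕ i ℕ.* k))))
      ≡R.≡⟨ ≡.cong₂ (λ u v → u ℚ.+ κ ℚ.* v)
             (Ms-leibniz s y (trans (trans (+-congˡ ε⁻¹≈ε) (+-identityʳ α)) α≈))
             (sum-cong-≗ (λ i → sum-cong-≗ (λ l → Ms-leibniz s (updateAt y i (shift l))
               (trans (+-congʳ α≈) (sym (expand-updateAt b y (λ j → pow ω (toℕ j ℕ.* k)) i l)))))) ⟩
    leibniz s (F y) ℚ.+ κ ℚ.* sum (λ i → sum (λ l → leibniz s (F (updateAt y i (shift l)))))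
      ≡R.≡⟨ ≡.cong (λ z → leibniz s (F y) ℚ.+ κ ℚ.* z) (≡R.begin
             sum (λ i → sum (λ l → leibniz s (F (updateAt y i (shift l)))))
               ≡R.≡⟨ sum-cong-≗ (λ i → leibniz-sum s (λ l → F (updateAt y i (shift l)))) ⟨
             sum (λ i → leibniz s (λ r j → sum (λ l → F (updateAt y i (shift l)) r j)))
               ≡R.≡⟨ leibniz-sum s (λ i r j → sum (λ l → F (updateAt y i (shift l)) r j)) ⟨
             leibniz s (λ r j → sum (λ i → sum (λ l → F (updateAt y i (shift l)) r j))) ≡R.∎) ⟩
    leibniz s (F y) ℚ.+ κ ℚ.* leibniz s (λ r j → sum (λ i → sum (λ l → F (updateAt y i (shift l)) r j)))
      ≡R.≡⟨ ≡.cong (leibniz s (F y) ℚ.+_) (≡.trans (≡.sym (leibniz-* s κ _)) (leibniz-cong s step)) ⟩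
    leibniz s (F y) ℚ.+ leibniz s (λ r j → F y (suc r) j)
      -- As `F y` ignores its second index, `leibniz s (F y)` is exactly the half of
      -- `leibniz (suc s) (F y)` that raises j.
      ≡R.≡⟨ ℚ.+-comm (leibniz s (F y)) (leibniz s (λ r j → F y (suc r) j)) ⟩
    leibniz (suc s) (F y) ≡R.∎
    where
    module ≡R = ≡.≡-Reasoning
    κ = ℕ→ℚ k
    h : Carrier → ℚ
    h z = ℕ→ℚ (Ms k s (α - z))
    F : (Fin b → SubfieldElement) → ℕ → ℕ → ℚ
    F y r _ = powℚ κ r ℚ.* E y r
    step : ∀ r j → κ ℚ.* sum (λ i → sum (λ l → F (updateAt y i (shift l)) r j)) ≡ F y (suc r) j
    step r j = ≡R.begin
      κ ℚ.* sum (λ i → sum (λ l → κʳ ℚ.* E′ i l))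
        ≡R.≡⟨ ≡.cong (κ ℚ.*_) (sum-cong-≗ (λ i → *-distribˡ-sum κʳ (E′ i))) ⟨
      κ ℚ.* sum (λ i → κʳ ℚ.* sum (E′ i))
        ≡R.≡⟨ ≡.cong (κ ℚ.*_) (*-distribˡ-sum κʳ (λ i → sum (E′ i))) ⟨
      κ ℚ.* (κʳ ℚ.* sum (λ i → sum (E′ i)))
        ≡R.≡⟨ ℚ.*-assoc κ κʳ (sum (λ i → sum (E′ i))) ⟨
      (κ ℚ.* κʳ) ℚ.* sum (λ i → sum (E′ i))
        ≡R.≡⟨ ≡.cong ((κ ℚ.* κʳ) ℚ.*_) (multinomialSum-suc shift weight weight-suc y r) ⟨
      F y (suc r) j ≡R.∎
      where
      κʳ = powℚ κ r
      E′ : Fin b → Fin n → ℚ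
      E′ i l = E (updateAt y i (shift l)) r

  -- The closed form of `leibniz` starts at r = 0 but `binomSum` starts at r = 1. The term split off
  -- is N_0, equal to 0 or 1, and it separates the two cases.
  Ms-binomSum : ∀ s {α} cs → IsCoordVec Q k b ω α cs →
    let N = Nr Q k b (λ i → cs i ≈ 0#) (λ i → cs i ≈? 0#)
    in (¬ α ≈ 0# → ℕ→ℚ (Ms k s α) ≡ binomSum s N) × (α ≈ 0# → ℕ→ℚ (Ms k s α) ≡ 1ℚ ℚ.+ binomSum s N)
  Ms-binomSum s {α} cs (cs∈ , α≈) =
    (λ α≉0 → ≡.trans (total (E-zero-false y α≈ α≉0)) (ℚ.+-identityˡ (binomSum s N′))) ,
    (λ α≈0 → total (E-zero-true y α≈ α≈0))
    where
    module ≡R = ≡.≡-Reasoning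
    N′ = Nr Q k b (λ i → cs i ≈ 0#) (λ i → cs i ≈? 0#)
    y : Fin b → SubfieldElement
    y i = cs i , cs∈ i
    total : ∀ {e} → E y 0 ≡ e → ℕ→ℚ (Ms k s α) ≡ e ℚ.+ binomSum s N′
    total {e} E≡e = ≡R.begin
      ℕ→ℚ (Ms k s α)
        ≡R.≡⟨ Ms-leibniz s y α≈ ⟩
      leibniz s (λ r _ → N′ r)
        ≡R.≡⟨ leibniz-closed s (λ r _ → N′ r) ⟩
      sum {suc s} (λ i → ℕ→ℚ (s C toℕ i) ℚ.* N′ (toℕ i))
        ≡R.≡⟨ ≡.cong₂ ℚ._+_ first (≡.sym (sumℚ-applyUpTo (λ r → ℕ→ℚ (s C r) ℚ.* N′ r) suc s)) ⟩
      e ℚ.+ binomSum s N′ ≡R.∎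
      where
      first : ℕ→ℚ (s C 0) ℚ.* N′ 0 ≡ e
      first = ≡.trans (ℚ.*-identityˡ (N′ 0)) (≡.trans (ℚ.*-identityˡ (E y 0)) E≡e)

open import Data.Nat using (_*_; _^_; _≤_; _<_)

theorem4p4 : ∀ {c ℓ} (p a b k : ℕ) → Prime p → 1 ≤ a → 1 < b →
  k * (b * (p ^ a ∸ 1)) ≡ p ^ (a * b) ∸ 1 →
  IsPrimitiveDivisor (b * (p ^ a ∸ 1)) p (a * b) →
  (R : CommutativeRing c ℓ) (dec : IsFieldDec R) (fin : FiniteOfOrder R (p ^ (a * b))) →
  let open CommutativeRing R
      open IsFieldDec dec
      open FieldOps R
      open Counting R dec fin
  in (ω : Carrier) → IsPrimitiveElement ω →
     (α : Carrier) →
     (∃ λ cs → IsCoordVec (p ^ a) k b ω α cs) ×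
     (∀ (cs : Fin b → Carrier) → IsCoordVec (p ^ a) k b ω α cs →
      ∀ (s : ℕ) → 1 ≤ s →
      let N = Nr (p ^ a) k b (λ i → cs i ≈ 0#) (λ i → cs i ≈? 0#)
      in (¬ (α ≈ 0#) → ℕ→ℚ (Ms k s α) ≡ binomSum s N) ×
         (α ≈ 0# → ℕ→ℚ (Ms k s α) ≡ Q.1ℚ Q.+ binomSum s N))
theorem4p4 p a b k pr 1≤a 1<b kb≡ (_ , noSmallerField) R dec fin ω generates α =
  coordinatesExist α , λ cs isCoordVec s _ → Ms-binomSum s cs isCoordVec
  where
  instance
    p≢0 : NonZero p
    p≢0 = prime⇒nonZero pr
    ab≢0 : NonZero (a ℕ.* b)
    ab≢0 = ℕ.m*n≢0 a b {{ℕ.>-nonZero 1≤a}} {{ℕ.>-nonZero (ℕ.<⇒≤ 1<b)}}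
  p≤p^ : ∀ e → .{{NonZero e}} → p ℕ.≤ p ℕ.^ e
  p≤p^ (suc e) = ℕ.m≤m*n p (p ℕ.^ e) {{ℕ.m^n≢0 p e}}
  2≤p^ : ∀ e → .{{NonZero e}} → 2 ℕ.≤ p ℕ.^ e
  2≤p^ e = ℕ.≤-trans (ℕ.nonTrivial⇒n>1 p {{prime⇒nonTrivial pr}}) (p≤p^ e)
  -- The truncated subtraction is exact because p ^ a is at least 2.
  m = p ℕ.^ a ∸ 2
  pᵃ≡2+m : p ℕ.^ a ≡ suc (suc m)
  pᵃ≡2+m = ≡.sym (ℕ.m+[n∸m]≡n (2≤p^ a {{ℕ.>-nonZero 1≤a}}))
  divisor : b ℕ.* (p ℕ.^ a ∸ 1) ≡ suc m ℕ.* b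
  divisor = ≡.trans (≡.cong (λ Q → b ℕ.* (Q ∸ 1)) pᵃ≡2+m) (ℕ.*-comm b (suc m))
  k*nb≡ : k ℕ.* (suc m ℕ.* b) ≡ p ℕ.^ (a ℕ.* b) ∸ 1
  k*nb≡ = ≡.trans (≡.cong (k ℕ.*_) (≡.sym divisor)) kb≡
  order : p ℕ.^ (a ℕ.* b) ≡ suc (k ℕ.* (suc m ℕ.* b))
  order = ≡.trans (≡.sym (ℕ.m+[n∸m]≡n (ℕ.<⇒≤ (2≤p^ (a ℕ.* b))))) (≡.cong suc (≡.sym k*nb≡))
  -- With k = 0 the order p ^ (a b) would be 1.
  positive : ∀ k → k ℕ.* (suc m ℕ.* b) ≡ p ℕ.^ (a ℕ.* b) ∸ 1 → 1 ℕ.≤ k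
  positive zero    e = contradiction (≡.subst (1 ℕ.≤_) (≡.sym e) (ℕ.∸-monoˡ-≤ 1 (2≤p^ (a ℕ.* b)))) λ ()
  positive (suc k) _ = ℕ.s≤s ℕ.z≤n
  open PowerSums p a b k m pr 1≤a 1<b pᵃ≡2+m order (positive k k*nb≡)
    (λ h 1≤h h<ab d∣ → noSmallerField h 1≤h h<ab (≡.subst (_∣ p ℕ.^ h ∸ 1) (≡.sym divisor) d∣))
    R dec fin ω generates
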